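{- Let $\tau\in\mathfrak{S}(1243,2143)$ be nonempty and set $k = |\tau|+1$; write $\tau,k$ for the permutation obtained by appending $k$ to $\tau$. Then $$G_{\tau,k}(x) = \frac{x\,J_\tau(x)}{(2-x-H_\tau(x))^2}.$$
   Context: A subsequence has type $\sigma$ if it has the same relative order as $\sigma$; a permutation avoids $\sigma$ if it has no subsequence of type $\sigma$. $\mathfrak{S}(1243,2143)$ is the set of all permutations (including the empty one) avoiding $1243$ and $2143$; $|\pi|$ is the length of $\pi$. For a nonempty permutation $\sigma$: $G_\sigma(x) = \sum x^{|\pi|}$ over $\pi\in\mathfrak{S}(1243,2143)$ containing exactly one subsequence of type $\sigma$; $H_\sigma(x) = \sum x^{|\pi|}$ over $\pi \in \mathfrak{S}(1243,2143)$ avoiding $\sigma$; and, with $k=|\sigma|+1$, $J_\sigma(x) = \sum x^{|\pi|}$ over $\pi\in\mathfrak{S}(1243,2143)$ that avoid $\sigma,k$ and contain exactly one subsequence of type $\sigma$. -}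

module Defs where

open import Data.Bool using (Bool; true; false; _∧_; not)
open import Data.Nat as ℕ using (ℕ; zero; suc; _<ᵇ_; _≡ᵇ_)
open import Data.Integer as ℤ using (ℤ; +_; -_)
open import Data.List using (List; []; _∷_; _++_; map; concatMap; length; filterᵇ; applyUpTo; upTo; [_])
open import Data.List.Properties using (≡-dec)
open import Relation.Nullary.Decidable using (⌊_⌋)

-- Permutations of length n are lists containing each of 1,…,n exactly once
-- (one-line notation, values 1-based as in the paper).

insertions : ℕ → List ℕ → List (List ℕ)
insertions x []       = [ x ∷ [] ]
insertions x (y ∷ ys) = (x ∷ y ∷ ys) ∷ map (y ∷_) (insertions x ys)

arrangements : List ℕ → List (List ℕ)
arrangements []       = [ [] ]
arrangements (x ∷ xs) = concatMap (insertions x) (arrangements xs)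

oneTo : ℕ → List ℕ
oneTo n = applyUpTo suc n

perms : ℕ → List (List ℕ)
perms n = arrangements (oneTo n)

subseqs : List ℕ → List (List ℕ)
subseqs []       = [ [] ]
subseqs (x ∷ xs) = map (x ∷_) (subseqs xs) ++ subseqs xs

-- standardization: replace each entry by the number of entries smaller than it.
-- Two sequences of distinct numbers have the same relative order iff
-- their standardizations coincide.
rank : List ℕ → ℕ → ℕ
rank a x = length (filterᵇ (_<ᵇ x) a)

std : List ℕ → List ℕ
std a = map (rank a) a

hasType : List ℕ → List ℕ → Bool
hasType σ s = ⌊ ≡-dec ℕ._≟_ (std s) (std σ) ⌋

occ : List ℕ → List ℕ → ℕ
occ σ π = length (filterᵇ (hasType σ) (subseqs π))

avoidsᵇ : List ℕ → List ℕ → Bool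
avoidsᵇ σ π = occ σ π ≡ᵇ 0

exactlyOnceᵇ : List ℕ → List ℕ → Bool
exactlyOnceᵇ σ π = occ σ π ≡ᵇ 1

p1243 p2143 : List ℕ
p1243 = 1 ∷ 2 ∷ 4 ∷ 3 ∷ []
p2143 = 2 ∷ 1 ∷ 4 ∷ 3 ∷ []

inClassᵇ : List ℕ → Bool
inClassᵇ π = avoidsᵇ p1243 π ∧ avoidsᵇ p2143 π

appendMax : List ℕ → List ℕ
appendMax σ = σ ++ [ suc (length σ) ]

count : (List ℕ → Bool) → ℕ → ℕ
count p n = length (filterᵇ p (perms n))

gCoeff : List ℕ → ℕ → ℕ
gCoeff σ = count (λ π → inClassᵇ π ∧ exactlyOnceᵇ σ π)

hCoeff : List ℕ → ℕ → ℕ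
hCoeff σ = count (λ π → inClassᵇ π ∧ avoidsᵇ σ π)

jCoeff : List ℕ → ℕ → ℕ
jCoeff σ = count (λ π → inClassᵇ π ∧ avoidsᵇ (appendMax σ) π ∧ exactlyOnceᵇ σ π)

Series : Set
Series = ℕ → ℤ

sumℤ : List ℤ → ℤ
sumℤ []       = + 0
sumℤ (x ∷ xs) = x ℤ.+ sumℤ xs

_⊛_ : Series → Series → Series
(a ⊛ b) n = sumℤ (map (λ i → a i ℤ.* b (n ℕ.∸ i)) (upTo (suc n)))

ofℕ : (ℕ → ℕ) → Series
ofℕ f n = + f n

xTimes : Series → Series
xTimes a zero    = + 0
xTimes a (suc n) = a n

twoMinusXMinus : Series → Series
twoMinusXMinus a zero          = + 2 ℤ.- a 0
twoMinusXMinus a (suc zero)    = - (+ 1) ℤ.- a 1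
twoMinusXMinus a (suc (suc n)) = - a (suc (suc n))

{-# OPTIONS --safe #-}
-- A permutation π of the class with maximum N, not in first position, is π₁ N π₂ where at most one
-- entry of π₁ is below any given entry of π₂.  Hence π₁ consists of its minimum s and of the
-- largest values, so that π amounts to the pair of the pattern ρ of π₁ and the permutation σ = s π₂,
-- and both range freely over the nonempty members of the class, with |π| = |ρ| + |σ|.  In π the k
-- of an occurrence of τ,k lies in π₁, at N, or in π₂, so that
--   occ (τ,k) π = occ (τ,k) ρ + occ τ ρ + occ (τ,k) σ.
-- Writing G = G_{τ,k}, H = H_τ, J = J_τ and H′ for the series of the members avoiding τ,k, this gives
--   H′ − 1 = x + x (H′ − 1) + (H − 1)(H′ − 1)   and   G = x G + J (H′ − 1) + (H − 1) G,
-- that is, (2 − x − H)(H′ − 1) = x and (2 − x − H) G = J (H′ − 1).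
module Submission where

open import Defs
open import Data.Nat using (ℕ; zero; suc; _+_; _∸_; _≤_; _<_; _≥_; _<ᵇ_; _≡ᵇ_; z≤n; s≤s)
import Data.Nat.Properties as ℕₚ
open import Algebra.Properties.CommutativeSemigroup ℕₚ.+-commutativeSemigroup using (interchange)
open import Data.Integer as ℤ using (ℤ; +_; -_)
import Data.Integer.Properties as ℤₚ
open import Data.Integer.Tactic.RingSolver using (solve-∀)
open import Data.Bool using (Bool; true; false; T; _∧_; not; if_then_else_)
open import Data.Bool.Properties using (∧-identityʳ; ∧-zeroʳ; T-≡; T-∧)
open import Data.Bool.ListAction using (all)
open import Data.Nat.ListAction using (sum)
open import Data.Nat.ListAction.Properties using (sum-↭)
open import Data.List hiding (find; all; sum; _∷ʳ_)
open import Data.List.Properties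
open import Data.Product using (_×_; _,_; proj₁; proj₂; ∃; ∃₂)
open import Data.Sum using (inj₁; inj₂)
open import Data.Empty using (⊥; ⊥-elim)
open import Data.Unit using (⊤; tt)
open import Function using (_∘_; id; _⇔_; mk⇔; Equivalence)
open import Relation.Nullary using (¬_; ¬?; yes; no)
open import Relation.Nullary.Decidable using (⌊_⌋; isYes≗does; does-⇔; dec-false; toWitness; fromWitness; decidable-stable; T?)
open import Relation.Binary using (tri<; tri≈; tri>)
open import Relation.Binary.PropositionalEquality hiding ([_])
open import Data.List.Relation.Unary.All as All using (All; []; _∷_)
import Data.List.Relation.Unary.All.Properties as Allₚ
open import Data.List.Relation.Unary.Any using (here; there)
open import Data.List.Relation.Unary.AllPairs using ([]; _∷_)
open import Data.List.Relation.Unary.Unique.Propositional using (Unique)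
import Data.List.Relation.Unary.Unique.Propositional.Properties as Uniqueₚ
open import Data.List.Membership.Propositional using (_∈_; _∉_; find; lose)
open import Data.List.Membership.Propositional.Properties
open import Data.List.Relation.Binary.Permutation.Propositional hiding (trans)
open import Data.List.Relation.Binary.Permutation.Setoid.Properties using (Unique-resp-↭)
open import Data.List.Relation.Binary.Permutation.Propositional.Properties
  using (∈-resp-↭; ↭-empty-inv; ↭-length; filter-↭; drop-mid; drop-∷; ↭-map-inv; shift; ++-comm)
  renaming (map⁺ to map-↭; ++⁺ to ++-↭; ++⁺ʳ to ++-↭ʳ; ++⁺ˡ to ++-↭ˡ)
open import Data.List.Relation.Binary.BagAndSetEquality using (∼bag⇒↭)
open import Data.List.Membership.Propositional.Properties.WithK using (unique∧set⇒bag)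
open import Data.List.Relation.Binary.Sublist.Propositional using (_⊆_; []; _∷_; _∷ʳ_; ⊆-refl; ⊆-trans; to∈; from∈; minimum)
open import Data.List.Relation.Binary.Sublist.Propositional.Properties
  using (All-resp-⊆; filter-⊆; length-mono-≤)
  renaming (filter⁺ to filter-mono; ++⁺ to ++-⊆)

-- Power series

-- Two entries of π₁ below an entry z of π₂ would form 1243 or 2143 together with N and z; this is
-- why at most one is allowed. Consequently no entry of π₂ can distinguish the prefix π₁ N from the
-- single entry s. Therefore s is kept in σ as well as in ρ: an occurrence that ends in π₂ may use
-- it. The sharing of s costs one entry and N restores it, so that the sizes add up. A permutation
-- containing τ,k contains τ. Hence, when there is exactly one occurrence in all and ρ accounts for
-- it, ρ has no τ,k and exactly one τ, which is the condition counted by J; when σ accounts for it,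
-- ρ avoids τ. Both the number of occurrences and the class condition are therefore put into a
-- left-to-right form that depends on a prefix only through its entries below each later entry.

tail⁺ : Series → Series
tail⁺ a n = a (suc n)

one : Series
one zero    = + 1
one (suc n) = + 0

⊛-suc : ∀ a b n → (a ⊛ b) (suc n) ≡ a 0 ℤ.* b (suc n) ℤ.+ (tail⁺ a ⊛ b) n
⊛-suc a b n = cong (λ l → a 0 ℤ.* b (suc n) ℤ.+ sumℤ l)
  (trans (map-applyUpTo suc (λ i → a i ℤ.* b (suc n ∸ i)) (suc n))
         (sym (map-upTo (λ i → a (suc i) ℤ.* b (n ∸ i)) (suc n))))

⊛-cong : ∀ {a a′ b b′} → a ≗ a′ → b ≗ b′ → a ⊛ b ≗ a′ ⊛ b′
⊛-cong a≗ b≗ n = cong sumℤ (map-cong (λ i → cong₂ ℤ._*_ (a≗ i) (b≗ (n ∸ i))) (upTo (suc n)))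

-- Additivity and homogeneity are joined in the form `k u + v` because the tail of a product and the
-- tail of `2 - x - h` both arise as such combinations.
⊛-linear : ∀ k u v c n →
  ((λ i → k ℤ.* u i ℤ.+ v i) ⊛ c) n ≡ k ℤ.* (u ⊛ c) n ℤ.+ (v ⊛ c) n
⊛-linear k u v c zero = lemma k (u 0) (v 0) (c 0)
  where
  lemma : ∀ k u v c → (k ℤ.* u ℤ.+ v) ℤ.* c ℤ.+ + 0 ≡ k ℤ.* (u ℤ.* c ℤ.+ + 0) ℤ.+ (v ℤ.* c ℤ.+ + 0)
  lemma = solve-∀
⊛-linear k u v c (suc n)
  rewrite ⊛-suc (λ i → k ℤ.* u i ℤ.+ v i) c n | ⊛-suc u c n | ⊛-suc v c n
        | ⊛-linear k (tail⁺ u) (tail⁺ v) c n = lemma k (u 0) (v 0) (c (suc n)) ((tail⁺ u ⊛ c) n) ((tail⁺ v ⊛ c) n)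
  where
  lemma : ∀ k u v c x y →
    (k ℤ.* u ℤ.+ v) ℤ.* c ℤ.+ (k ℤ.* x ℤ.+ y) ≡ k ℤ.* (u ℤ.* c ℤ.+ x) ℤ.+ (v ℤ.* c ℤ.+ y)
  lemma = solve-∀

-- The mirror image of `⊛-suc`, splitting off the head of the right factor; the two together give
-- commutativity by induction.
⊛-sucʳ : ∀ a b n → (a ⊛ b) (suc n) ≡ b 0 ℤ.* a (suc n) ℤ.+ (a ⊛ tail⁺ b) n
⊛-sucʳ a b zero = lemma (a 0) (a 1) (b 0) (b 1)
  where
  lemma : ∀ a₀ a₁ b₀ b₁ → a₀ ℤ.* b₁ ℤ.+ (a₁ ℤ.* b₀ ℤ.+ + 0) ≡ b₀ ℤ.* a₁ ℤ.+ (a₀ ℤ.* b₁ ℤ.+ + 0)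
  lemma = solve-∀
⊛-sucʳ a b (suc n)
  rewrite ⊛-suc a b (suc n) | ⊛-sucʳ (tail⁺ a) b n | ⊛-suc a (tail⁺ b) n =
  lemma (a 0 ℤ.* b (suc (suc n))) (b 0 ℤ.* a (suc (suc n))) ((tail⁺ a ⊛ tail⁺ b) n)
  where
  lemma : ∀ x y z → x ℤ.+ (y ℤ.+ z) ≡ y ℤ.+ (x ℤ.+ z)
  lemma = solve-∀

⊛-comm : ∀ a b → a ⊛ b ≗ b ⊛ a
⊛-comm a b zero    = cong (ℤ._+ + 0) (ℤₚ.*-comm (a 0) (b 0))
⊛-comm a b (suc n) rewrite ⊛-sucʳ a b n | ⊛-suc b a n =
  cong (λ x → b 0 ℤ.* a (suc n) ℤ.+ x) (⊛-comm a (tail⁺ b) n)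

⊛-assoc : ∀ a b c → (a ⊛ b) ⊛ c ≗ a ⊛ (b ⊛ c)
⊛-assoc a b c zero = lemma (a 0) (b 0) (c 0)
  where
  lemma : ∀ a b c → (a ℤ.* b ℤ.+ + 0) ℤ.* c ℤ.+ + 0 ≡ a ℤ.* (b ℤ.* c ℤ.+ + 0) ℤ.+ + 0
  lemma = solve-∀
⊛-assoc a b c (suc n) = begin
  ((a ⊛ b) ⊛ c) (suc n)
    ≡⟨ ⊛-suc (a ⊛ b) c n ⟩
  (a ⊛ b) 0 ℤ.* c (suc n) ℤ.+ (tail⁺ (a ⊛ b) ⊛ c) n
    ≡⟨ cong (λ x → (a ⊛ b) 0 ℤ.* c (suc n) ℤ.+ x)
         (trans (⊛-cong {b = c} (⊛-suc a b) (λ _ → refl) n)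
                (⊛-linear (a 0) (tail⁺ b) (tail⁺ a ⊛ b) c n)) ⟩
  (a ⊛ b) 0 ℤ.* c (suc n) ℤ.+ (a 0 ℤ.* (tail⁺ b ⊛ c) n ℤ.+ ((tail⁺ a ⊛ b) ⊛ c) n)
    ≡⟨ cong (λ x → (a ⊛ b) 0 ℤ.* c (suc n) ℤ.+ (a 0 ℤ.* (tail⁺ b ⊛ c) n ℤ.+ x)) (⊛-assoc (tail⁺ a) b c n) ⟩
  (a ⊛ b) 0 ℤ.* c (suc n) ℤ.+ (a 0 ℤ.* (tail⁺ b ⊛ c) n ℤ.+ (tail⁺ a ⊛ (b ⊛ c)) n)
    ≡⟨ lemma (a 0) (b 0) (c (suc n)) ((tail⁺ b ⊛ c) n) ((tail⁺ a ⊛ (b ⊛ c)) n) ⟩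
  a 0 ℤ.* (b 0 ℤ.* c (suc n) ℤ.+ (tail⁺ b ⊛ c) n) ℤ.+ (tail⁺ a ⊛ (b ⊛ c)) n
    ≡⟨ cong (λ x → a 0 ℤ.* x ℤ.+ (tail⁺ a ⊛ (b ⊛ c)) n) (⊛-suc b c n) ⟨
  a 0 ℤ.* (b ⊛ c) (suc n) ℤ.+ (tail⁺ a ⊛ (b ⊛ c)) n
    ≡⟨ ⊛-suc a (b ⊛ c) n ⟨
  (a ⊛ (b ⊛ c)) (suc n) ∎
  where
  open ≡-Reasoning
  lemma : ∀ a b c x y → (a ℤ.* b ℤ.+ + 0) ℤ.* c ℤ.+ (a ℤ.* x ℤ.+ y) ≡ a ℤ.* (b ℤ.* c ℤ.+ x) ℤ.+ y
  lemma = solve-∀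

⊛-zeroˡ : ∀ a n → ((λ _ → + 0) ⊛ a) n ≡ + 0
⊛-zeroˡ a zero    = refl
⊛-zeroˡ a (suc n) = trans (⊛-suc (λ _ → + 0) a n) (trans (ℤₚ.+-identityˡ _) (⊛-zeroˡ a n))

⊛-identityˡ : ∀ a → one ⊛ a ≗ a
⊛-identityˡ a zero    = trans (ℤₚ.+-identityʳ _) (ℤₚ.*-identityˡ (a 0))
⊛-identityˡ a (suc n) = trans (⊛-suc one a n)
  (trans (cong₂ ℤ._+_ (ℤₚ.*-identityˡ (a (suc n))) (⊛-zeroˡ a n)) (ℤₚ.+-identityʳ _))

-- For h(0) = 1, multiplication by 2 - x - h is a ↦ a - x a - (h - 1) a.
⊛-twoMinusXMinus : ∀ h a n → h 0 ≡ + 1 →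
  (twoMinusXMinus h ⊛ a) (suc n) ≡ a (suc n) ℤ.- (a n ℤ.+ (tail⁺ h ⊛ a) n)
⊛-twoMinusXMinus h a n h₀ = begin
  (twoMinusXMinus h ⊛ a) (suc n)
    ≡⟨ ⊛-suc (twoMinusXMinus h) a n ⟩
  (+ 2 ℤ.- h 0) ℤ.* a (suc n) ℤ.+ (tail⁺ (twoMinusXMinus h) ⊛ a) n
    ≡⟨ cong₂ (λ x y → (+ 2 ℤ.- x) ℤ.* a (suc n) ℤ.+ y) h₀
         (trans (⊛-cong {b = a} tail-D (λ _ → refl) n)
           (trans (⊛-linear (- + 1) (tail⁺ h) (λ i → - + 1 ℤ.* one i ℤ.+ + 0) a n)
              (cong (λ x → - + 1 ℤ.* (tail⁺ h ⊛ a) n ℤ.+ x)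
                (trans (⊛-linear (- + 1) one (λ _ → + 0) a n)
                  (cong₂ (λ x y → - + 1 ℤ.* x ℤ.+ y) (⊛-identityˡ a n) (⊛-zeroˡ a n)))))) ⟩
  (+ 2 ℤ.- + 1) ℤ.* a (suc n) ℤ.+ (- + 1 ℤ.* (tail⁺ h ⊛ a) n ℤ.+ (- + 1 ℤ.* a n ℤ.+ + 0))
    ≡⟨ lemma (a (suc n)) (a n) ((tail⁺ h ⊛ a) n) ⟩
  a (suc n) ℤ.- (a n ℤ.+ (tail⁺ h ⊛ a) n) ∎
  where
  open ≡-Reasoning
  -- The `-x` contributes only at index 0 of the tail, as `-1` times `one`; the final `+ 0` allows
  -- `⊛-linear` to be applied twice.
  tail-D : ∀ i → tail⁺ (twoMinusXMinus h) i ≡ - + 1 ℤ.* h (suc i) ℤ.+ (- + 1 ℤ.* one i ℤ.+ + 0)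
  tail-D zero    = lemma₀ (h 1)
    where
    lemma₀ : ∀ x → - + 1 ℤ.- x ≡ - + 1 ℤ.* x ℤ.+ - + 1
    lemma₀ = solve-∀
  tail-D (suc i) = lemma₀ (h (suc (suc i)))
    where
    lemma₀ : ∀ x → - x ≡ - + 1 ℤ.* x ℤ.+ + 0
    lemma₀ = solve-∀
  lemma : ∀ x y z → (+ 2 ℤ.- + 1) ℤ.* x ℤ.+ (- + 1 ℤ.* z ℤ.+ (- + 1 ℤ.* y ℤ.+ + 0)) ≡ x ℤ.- (y ℤ.+ z)
  lemma = solve-∀

⊛-xTimes-one : ∀ a → a ⊛ xTimes one ≗ xTimes a
⊛-xTimes-one a n = trans (⊛-comm a (xTimes one) n) (go n)
  where
  go : xTimes one ⊛ a ≗ xTimes a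
  go zero    = refl
  go (suc n) = trans (⊛-suc (xTimes one) a n) (trans (ℤₚ.+-identityˡ _) (⊛-identityˡ a n))

-- No series is inverted. With `D = 2 - x - h` the recurrences say `D h₊ = x` and `D g = j h₊`, and
-- multiplying the second by `D` eliminates `h₊`. The constant terms cover index 0, on which the
-- recurrences are silent.
series-solution : ∀ (g h h₊ j : Series) →
  h 0 ≡ + 1 → g 0 ≡ + 0 → h₊ 0 ≡ + 0 → j 0 ≡ + 0 →
  (∀ n → h₊ (suc n) ≡ one n ℤ.+ h₊ n ℤ.+ (tail⁺ h ⊛ h₊) n) →
  (∀ n → g (suc n) ≡ g n ℤ.+ ((tail⁺ j ⊛ h₊) n ℤ.+ (tail⁺ h ⊛ g) n)) →
  g ⊛ (twoMinusXMinus h ⊛ twoMinusXMinus h) ≗ xTimes j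
series-solution g h h₊ j h₀ g₀ h₊₀ j₀ rec-h rec-g n = begin
  (g ⊛ (D ⊛ D)) n     ≡⟨ ⊛-comm g (D ⊛ D) n ⟩
  ((D ⊛ D) ⊛ g) n     ≡⟨ ⊛-assoc D D g n ⟩
  (D ⊛ (D ⊛ g)) n     ≡⟨ ⊛-cong {a = D} (λ _ → refl) Dg n ⟩
  (D ⊛ (j ⊛ h₊)) n    ≡⟨ ⊛-assoc D j h₊ n ⟨
  ((D ⊛ j) ⊛ h₊) n    ≡⟨ ⊛-cong {b = h₊} (⊛-comm D j) (λ _ → refl) n ⟩
  ((j ⊛ D) ⊛ h₊) n    ≡⟨ ⊛-assoc j D h₊ n ⟩
  (j ⊛ (D ⊛ h₊)) n    ≡⟨ ⊛-cong {a = j} (λ _ → refl) Dh₊ n ⟩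
  (j ⊛ xTimes one) n  ≡⟨ ⊛-xTimes-one j n ⟩
  xTimes j n          ∎
  where
  open ≡-Reasoning
  D = twoMinusXMinus h
  Dh₊ : D ⊛ h₊ ≗ xTimes one
  Dh₊ zero    = trans (cong (λ x → D 0 ℤ.* x ℤ.+ + 0) h₊₀) (cong (ℤ._+ + 0) (ℤₚ.*-zeroʳ (D 0)))
  Dh₊ (suc n) = trans (⊛-twoMinusXMinus h h₊ n h₀)
    (trans (cong (ℤ._- (h₊ n ℤ.+ (tail⁺ h ⊛ h₊) n)) (rec-h n)) (lemma (one n) (h₊ n) ((tail⁺ h ⊛ h₊) n)))
    where
    lemma : ∀ x y z → x ℤ.+ y ℤ.+ z ℤ.- (y ℤ.+ z) ≡ x
    lemma = solve-∀
  Dg : D ⊛ g ≗ j ⊛ h₊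
  Dg zero    = trans (cong₂ (λ x y → D 0 ℤ.* x ℤ.+ + 0) g₀ h₊₀)
    (trans (cong (ℤ._+ + 0) (ℤₚ.*-zeroʳ (D 0))) (sym (cong (λ x → x ℤ.* h₊ 0 ℤ.+ + 0) j₀)))
  Dg (suc n) = trans (⊛-twoMinusXMinus h g n h₀)
    (trans (cong (ℤ._- (g n ℤ.+ (tail⁺ h ⊛ g) n)) (rec-g n))
    (trans (lemma (g n) ((tail⁺ j ⊛ h₊) n) ((tail⁺ h ⊛ g) n))
    (sym (trans (⊛-suc j h₊ n) (trans (cong (λ x → x ℤ.* h₊ (suc n) ℤ.+ (tail⁺ j ⊛ h₊) n) j₀) (ℤₚ.+-identityˡ _))))))
    where
    lemma : ∀ x y z → x ℤ.+ (y ℤ.+ z) ℤ.- (x ℤ.+ z) ≡ y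
    lemma = solve-∀

-- Weighted sums over lists and the enumeration of permutations

wsum : {A : Set} → (A → ℤ) → List A → ℤ
wsum w xs = sumℤ (map w xs)

module _ {A : Set} where

  wsum-cong-∈ : ∀ {w w′ : A → ℤ} xs → (∀ {x} → x ∈ xs → w x ≡ w′ x) → wsum w xs ≡ wsum w′ xs
  wsum-cong-∈ []       eq = refl
  wsum-cong-∈ (x ∷ xs) eq = cong₂ ℤ._+_ (eq (here refl)) (wsum-cong-∈ xs (eq ∘ there))

  wsum-↭ : ∀ (w : A → ℤ) {xs ys} → xs ↭ ys → wsum w xs ≡ wsum w ys
  wsum-↭ w refl          = refl
  wsum-↭ w (prep x p)    = cong (λ s → w x ℤ.+ s) (wsum-↭ w p)
  wsum-↭ w (swap x y p)  = trans (cong (λ s → w x ℤ.+ (w y ℤ.+ s)) (wsum-↭ w p)) (lemma (w x) (w y) _)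
    where
    lemma : ∀ a b c → a ℤ.+ (b ℤ.+ c) ≡ b ℤ.+ (a ℤ.+ c)
    lemma = solve-∀
  wsum-↭ w (_↭_.trans p q)   = trans (wsum-↭ w p) (wsum-↭ w q)

  wsum-++ : ∀ (w : A → ℤ) xs ys → wsum w (xs ++ ys) ≡ wsum w xs ℤ.+ wsum w ys
  wsum-++ w []       ys = sym (ℤₚ.+-identityˡ _)
  wsum-++ w (x ∷ xs) ys = trans (cong (λ s → w x ℤ.+ s) (wsum-++ w xs ys)) (sym (ℤₚ.+-assoc (w x) _ _))

  wsum-map : ∀ {B : Set} (w : A → ℤ) (f : B → A) xs → wsum w (map f xs) ≡ wsum (w ∘ f) xs
  wsum-map w f xs = cong sumℤ (sym (map-∘ xs))

  wsum-concatMap : ∀ {B : Set} (w : A → ℤ) (f : B → List A) xs → wsum w (concatMap f xs) ≡ wsum (wsum w ∘ f) xs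
  wsum-concatMap w f []       = refl
  wsum-concatMap w f (x ∷ xs) = trans (wsum-++ w (f x) (concatMap f xs))
    (cong (λ s → wsum w (f x) ℤ.+ s) (wsum-concatMap w f xs))

  wsum-+ : ∀ (w w′ : A → ℤ) xs → wsum (λ x → w x ℤ.+ w′ x) xs ≡ wsum w xs ℤ.+ wsum w′ xs
  wsum-+ w w′ []       = refl
  wsum-+ w w′ (x ∷ xs) = trans (cong (λ s → w x ℤ.+ w′ x ℤ.+ s) (wsum-+ w w′ xs)) (lemma (w x) (w′ x) _ _)
    where
    lemma : ∀ a b c d → a ℤ.+ b ℤ.+ (c ℤ.+ d) ≡ a ℤ.+ c ℤ.+ (b ℤ.+ d)
    lemma = solve-∀

  wsum-*ˡ : ∀ k (w : A → ℤ) xs → wsum (λ x → k ℤ.* w x) xs ≡ k ℤ.* wsum w xs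
  wsum-*ˡ k w []       = sym (ℤₚ.*-zeroʳ k)
  wsum-*ˡ k w (x ∷ xs) = trans (cong (λ s → k ℤ.* w x ℤ.+ s) (wsum-*ˡ k w xs)) (sym (ℤₚ.*-distribˡ-+ k (w x) _))

  wsum-*ʳ : ∀ k (w : A → ℤ) xs → wsum (λ x → w x ℤ.* k) xs ≡ wsum w xs ℤ.* k
  wsum-*ʳ k w xs = trans (wsum-cong-∈ xs (λ {x} _ → ℤₚ.*-comm (w x) k)) (trans (wsum-*ˡ k w xs) (ℤₚ.*-comm k _))

wsum-cartesian : ∀ {A B : Set} (u : A → ℤ) (v : B → ℤ) xs ys →
  wsum (λ x → wsum (λ y → u x ℤ.* v y) ys) xs ≡ wsum u xs ℤ.* wsum v ys
wsum-cartesian u v xs ys = trans (wsum-cong-∈ xs (λ {x} _ → wsum-*ˡ (u x) v ys)) (wsum-*ʳ (wsum v ys) u xs)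

𝟙 : Bool → ℤ
𝟙 true  = + 1
𝟙 false = + 0

-- Separates membership in the class from the condition being counted, so that every coefficient
-- becomes a 0/1-weighted sum over one and the same list.
length-filterᵇ-∧ : ∀ {A : Set} (p q : A → Bool) xs →
  + length (filterᵇ (λ x → p x ∧ q x) xs) ≡ wsum (𝟙 ∘ q) (filterᵇ p xs)
length-filterᵇ-∧ p q [] = refl
length-filterᵇ-∧ p q (x ∷ xs) with p x
... | false = length-filterᵇ-∧ p q xs
... | true with q x
...   | true  = trans (ℤₚ.pos-+ 1 _) (cong (λ s → + 1 ℤ.+ s) (length-filterᵇ-∧ p q xs))
...   | false = trans (length-filterᵇ-∧ p q xs) (sym (ℤₚ.+-identityˡ _))

unique-concatMap : ∀ {A B : Set} (f : A → List B) {xs} → Unique xs →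
  (∀ {x} → x ∈ xs → Unique (f x)) →
  (∀ {x y z} → x ∈ xs → y ∈ xs → z ∈ f x → z ∈ f y → x ≡ y) →
  Unique (concatMap f xs)
unique-concatMap f []        uf inj = []
unique-concatMap f {x ∷ xs} (x∉ ∷ uxs) uf inj =
  Uniqueₚ.++⁺ (uf (here refl))
    (unique-concatMap f uxs (uf ∘ there) (λ p q → inj (there p) (there q)))
    λ (z∈fx , z∈rest) →
      let (y , y∈xs , z∈fy) = find (∈-concatMap⁻ f {xs = xs} z∈rest)
      in All.lookup x∉ y∈xs (inj (here refl) (there y∈xs) z∈fx z∈fy)

unique-map-∈ : ∀ {A B : Set} (f : A → B) {xs} → Unique xs →
  (∀ {x y} → x ∈ xs → y ∈ xs → f x ≡ f y → x ≡ y) → Unique (map f xs)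
unique-map-∈ f []          inj = []
unique-map-∈ f {x ∷ xs} (x∉ ∷ uxs)  inj =
  Allₚ.map⁺ (All.tabulate (λ y∈ eq → All.lookup x∉ y∈ (inj (here refl) (there y∈) eq)))
  ∷ unique-map-∈ f uxs (λ p q → inj (there p) (there q))

-- Bijections are replaced by this: two duplicate-free lists with the same members are
-- rearrangements of each other, and weighted sums ignore order.
set-unique⇒↭ : ∀ {A : Set} {xs ys : List A} → Unique xs → Unique ys →
  (∀ {x} → x ∈ xs → x ∈ ys) → (∀ {x} → x ∈ ys → x ∈ xs) → xs ↭ ys
set-unique⇒↭ uxs uys to from = ∼bag⇒↭ (unique∧set⇒bag uxs uys (mk⇔ to from))

∈-insertions⁻ : ∀ {x} xs {zs} → zs ∈ insertions x xs → zs ↭ x ∷ xs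
∈-insertions⁻ []       (here refl) = ↭-refl
∈-insertions⁻ (y ∷ ys) (here refl) = ↭-refl
∈-insertions⁻ {x} (y ∷ ys) (there p) with ws , ws∈ , refl ← map∷⁻ p =
  ↭-trans (prep y (∈-insertions⁻ ys ws∈)) (swap y x ↭-refl)

∈-insertions⁺ : ∀ x us vs → us ++ x ∷ vs ∈ insertions x (us ++ vs)
∈-insertions⁺ x []       []       = here refl
∈-insertions⁺ x []       (v ∷ vs) = here refl
∈-insertions⁺ x (u ∷ us) vs       = there (∈-map⁺ (u ∷_) (∈-insertions⁺ x us vs))

unique-insertions : ∀ {x} ys → x ∉ ys → Unique (insertions x ys)
unique-insertions []       x∉ = [] ∷ []
unique-insertions (y ∷ ys) x∉ =
  All.tabulate distinct
  ∷ Uniqueₚ.map⁺ ∷-injectiveʳ (unique-insertions ys (x∉ ∘ there))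
  where
  distinct : ∀ {z} → z ∈ map (y ∷_) (insertions _ ys) → _ ∷ y ∷ ys ≢ z
  distinct z∈ eq with _ , _ , refl ← map∷⁻ z∈ = x∉ (here (∷-injectiveˡ eq))

-- A left inverse of inserting `x` into a list without `x`; it shows that different arrangements
-- have disjoint lists of insertions.
remove : ℕ → List ℕ → List ℕ
remove x = filter (λ z → ¬? (x ℕₚ.≟ z))

remove-insertions : ∀ {x} ys {zs} → x ∉ ys → zs ∈ insertions x ys → remove x zs ≡ ys
remove-insertions {x} ys x∉ zs∈ = go ys x∉ zs∈
  where
  ≢x? = λ z → ¬? (x ℕₚ.≟ z)
  unchanged : ∀ ys → x ∉ ys → remove x ys ≡ ys
  unchanged ys x∉ = filter-all ≢x? (All.tabulate λ y∈ x≡y → x∉ (subst (_∈ ys) (sym x≡y) y∈))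
  go : ∀ ys {zs} → x ∉ ys → zs ∈ insertions x ys → remove x zs ≡ ys
  go []       x∉ (here refl) = filter-reject ≢x? (λ x≢x → x≢x refl)
  go (y ∷ ys) x∉ (here refl) = trans (filter-reject ≢x? (λ x≢x → x≢x refl)) (unchanged (y ∷ ys) x∉)
  go (y ∷ ys) x∉ (there p) with _ , ws∈ , refl ← map∷⁻ p =
    trans (filter-accept ≢x? (x∉ ∘ here)) (cong (y ∷_) (go ys (x∉ ∘ there) ws∈))

∈-arrangements⁻ : ∀ xs {ys} → ys ∈ arrangements xs → ys ↭ xs
∈-arrangements⁻ []       (here refl) = ↭-refl
∈-arrangements⁻ (x ∷ xs) p with zs , zs∈ , q ← find (∈-concatMap⁻ (insertions x) {xs = arrangements xs} p) =
  ↭-trans (∈-insertions⁻ zs q) (prep x (∈-arrangements⁻ xs zs∈))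

∈-arrangements⁺ : ∀ xs {ys} → ys ↭ xs → ys ∈ arrangements xs
∈-arrangements⁺ []       p with refl ← ↭-empty-inv p = here refl
∈-arrangements⁺ (x ∷ xs) p with us , vs , refl ← ∈-∃++ (∈-resp-↭ (↭-sym p) (here refl)) =
  ∈-concatMap⁺ (insertions x) (lose (∈-arrangements⁺ xs (drop-mid us [] p)) (∈-insertions⁺ x us vs))

unique-arrangements : ∀ {xs} → Unique xs → Unique (arrangements xs)
unique-arrangements []                     = [] ∷ []
unique-arrangements {x ∷ xs} (x∉xs ∷ uxs) =
  unique-concatMap (insertions x) (unique-arrangements uxs)
    (λ {ys} ys∈ → unique-insertions ys (x∉ ys∈))
    (λ {ys} {zs} ys∈ zs∈ p q →
      trans (sym (remove-insertions ys (x∉ ys∈) p)) (remove-insertions zs (x∉ zs∈) q))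
  where
  x∉ : ∀ {ys} → ys ∈ arrangements xs → x ∉ ys
  x∉ ys∈ x∈ys = All.lookup x∉xs (∈-resp-↭ (∈-arrangements⁻ xs ys∈) x∈ys) refl

unique-oneTo : ∀ n → Unique (oneTo n)
unique-oneTo n = Uniqueₚ.applyUpTo⁺₁ suc n (λ i<j _ eq → ℕₚ.<⇒≢ i<j (ℕₚ.suc-injective eq))

-- Occurrences of τ,k

cnt : {A : Set} → (A → Bool) → List A → ℕ
cnt p xs = length (filterᵇ p xs)

bit : Bool → ℕ
bit b = if b then 1 else 0

module _ {A : Set} where

  cnt-∷ : ∀ (p : A → Bool) x xs → cnt p (x ∷ xs) ≡ bit (p x) + cnt p xs
  cnt-∷ p x xs with p x
  ... | true  = refl
  ... | false = refl

  cnt-cong : ∀ {p q : A → Bool} → p ≗ q → cnt p ≗ cnt q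
  cnt-cong         p≗q []       = refl
  cnt-cong {p} {q} p≗q (x ∷ xs) =
    trans (cnt-∷ p x xs) (trans (cong₂ (λ b c → bit b + c) (p≗q x) (cnt-cong p≗q xs)) (sym (cnt-∷ q x xs)))

  cnt-++ : ∀ (p : A → Bool) xs ys → cnt p (xs ++ ys) ≡ cnt p xs + cnt p ys
  cnt-++ p xs ys = trans (cong length (filter-++ _ xs ys)) (length-++ (filterᵇ p xs))

  cnt-none : ∀ (xs : List A) → cnt (λ _ → false) xs ≡ 0
  cnt-none []       = refl
  cnt-none (x ∷ xs) = cnt-none xs

cnt-map : ∀ {A B : Set} (p : A → Bool) (f : B → A) xs → cnt p (map f xs) ≡ cnt (p ∘ f) xs
cnt-map p f []       = refl
cnt-map p f (x ∷ xs) = trans (cnt-∷ p (f x) (map f xs))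
  (trans (cong (λ c → bit (p (f x)) + c) (cnt-map p f xs)) (sym (cnt-∷ (p ∘ f) x xs)))

cnt-subseqs-∷ : ∀ p x xs → cnt p (subseqs (x ∷ xs)) ≡ cnt (p ∘ (x ∷_)) (subseqs xs) + cnt p (subseqs xs)
cnt-subseqs-∷ p x xs = trans (cnt-++ p (map (x ∷_) (subseqs xs)) (subseqs xs))
  (cong (λ c → c + cnt p (subseqs xs)) (cnt-map p (x ∷_) (subseqs xs)))

cnt-subseqs-∷ʳ : ∀ p xs z →
  cnt p (subseqs (xs ++ [ z ])) ≡ cnt p (subseqs xs) + cnt (λ s → p (s ++ [ z ])) (subseqs xs)
cnt-subseqs-∷ʳ p [] z = trans (cnt-subseqs-∷ p z [])
  (trans (ℕₚ.+-comm (cnt (p ∘ (z ∷_)) [ [] ]) (cnt p [ [] ]))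
    (cong (λ c → cnt p [ [] ] + c)
      (trans (cnt-∷ (p ∘ (z ∷_)) [] []) (sym (cnt-∷ (λ s → p (s ++ [ z ])) [] [])))))
cnt-subseqs-∷ʳ p (x ∷ xs) z = begin
  cnt p (subseqs (x ∷ xs ++ [ z ]))
    ≡⟨ cnt-subseqs-∷ p x (xs ++ [ z ]) ⟩
  cnt (p ∘ (x ∷_)) (subseqs (xs ++ [ z ])) + cnt p (subseqs (xs ++ [ z ]))
    ≡⟨ cong₂ _+_ (cnt-subseqs-∷ʳ (p ∘ (x ∷_)) xs z) (cnt-subseqs-∷ʳ p xs z) ⟩
  (cnt (p ∘ (x ∷_)) S + cnt (λ s → p (x ∷ s ++ [ z ])) S) + (cnt p S + cnt (λ s → p (s ++ [ z ])) S)
    ≡⟨ interchange (cnt (p ∘ (x ∷_)) S) (cnt (λ s → p (x ∷ s ++ [ z ])) S) (cnt p S) _ ⟩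
  (cnt (p ∘ (x ∷_)) S + cnt p S) + (cnt (λ s → p (x ∷ s ++ [ z ])) S + cnt (λ s → p (s ++ [ z ])) S)
    ≡⟨ cong₂ _+_ (cnt-subseqs-∷ p x xs) (cnt-subseqs-∷ (λ s → p (s ++ [ z ])) x xs) ⟨
  cnt p (subseqs (x ∷ xs)) + cnt (λ s → p (s ++ [ z ])) (subseqs (x ∷ xs)) ∎
  where
  open ≡-Reasoning
  S = subseqs xs

-- Choosing positions among the entries that satisfy `q` is choosing positions in the filtered list,
-- so the multiplicities agree too.
cnt-subseqs-filter : ∀ p q xs →
  cnt (λ s → p s ∧ all q s) (subseqs xs) ≡ cnt p (subseqs (filterᵇ q xs))
cnt-subseqs-filter p q []       = trans (cnt-∷ (λ s → p s ∧ all q s) [] [])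
  (trans (cong (λ b → bit b + 0) (∧-identityʳ (p []))) (sym (cnt-∷ p [] [])))
cnt-subseqs-filter p q (x ∷ xs) = trans (cnt-subseqs-∷ (λ s → p s ∧ all q s) x xs) step
  where
  step : cnt (λ s → p (x ∷ s) ∧ all q (x ∷ s)) (subseqs xs) + cnt (λ s → p s ∧ all q s) (subseqs xs)
         ≡ cnt p (subseqs (filterᵇ q (x ∷ xs)))
  step with q x
  ... | true  = trans (cong₂ _+_ (cnt-subseqs-filter (p ∘ (x ∷_)) q xs) (cnt-subseqs-filter p q xs))
                      (sym (cnt-subseqs-∷ p x (filterᵇ q xs)))
  ... | false = trans (cong (λ c → c + cnt (λ s → p s ∧ all q s) (subseqs xs))
                        (trans (cnt-cong (λ s → ∧-zeroʳ (p (x ∷ s))) (subseqs xs)) (cnt-none (subseqs xs))))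
                      (cnt-subseqs-filter p q xs)

-- Invariance of occurrences under increasing relabelling

subseqs-map : ∀ f xs → subseqs (map f xs) ≡ map (map f) (subseqs xs)
subseqs-map f []       = refl
subseqs-map f (x ∷ xs) = begin
  map (f x ∷_) (subseqs (map f xs)) ++ subseqs (map f xs)
    ≡⟨ cong (λ S → map (f x ∷_) S ++ S) (subseqs-map f xs) ⟩
  map (f x ∷_) (map (map f) (subseqs xs)) ++ map (map f) (subseqs xs)
    ≡⟨ cong (_++ map (map f) (subseqs xs)) (trans (sym (map-∘ (subseqs xs))) (map-∘ (subseqs xs))) ⟩
  map (map f) (map (x ∷_) (subseqs xs)) ++ map (map f) (subseqs xs)
    ≡⟨ map-++ (map f) (map (x ∷_) (subseqs xs)) (subseqs xs) ⟨
  map (map f) (subseqs (x ∷ xs)) ∎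
  where open ≡-Reasoning

-- Stated as an equality of Booleans because `rank` filters by `<ᵇ`: the filters before and after
-- relabelling then agree pointwise.
StrictlyMonotone : (ℕ → ℕ) → Set
StrictlyMonotone f = ∀ x y → (f x <ᵇ f y) ≡ (x <ᵇ y)

rank-map : ∀ {f} → StrictlyMonotone f → ∀ a x → rank (map f a) (f x) ≡ rank a x
rank-map {f} mono a x = trans (cnt-map (_<ᵇ f x) f a) (cnt-cong (λ y → mono y x) a)

std-map : ∀ {f} → StrictlyMonotone f → ∀ a → std (map f a) ≡ std a
std-map mono a = trans (sym (map-∘ a)) (map-cong (rank-map mono a) a)

occ-map : ∀ {f} → StrictlyMonotone f → ∀ σ π → occ σ (map f π) ≡ occ σ π
occ-map {f} mono σ π = begin
  cnt (hasType σ) (subseqs (map f π))        ≡⟨ cong (cnt (hasType σ)) (subseqs-map f π) ⟩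
  cnt (hasType σ) (map (map f) (subseqs π))  ≡⟨ cnt-map (hasType σ) (map f) (subseqs π) ⟩
  cnt (hasType σ ∘ map f) (subseqs π)        ≡⟨ cnt-cong (λ s → cong (λ t → ⌊ ≡-dec ℕₚ._≟_ t (std σ) ⌋) (std-map mono s)) (subseqs π) ⟩
  cnt (hasType σ) (subseqs π)                ∎
  where open ≡-Reasoning

-- Appending a last entry

rank-∷ʳ : ∀ s z x → rank (s ++ [ z ]) x ≡ rank s x + bit (z <ᵇ x)
rank-∷ʳ s z x = trans (cnt-++ (_<ᵇ x) s [ z ]) (cong (λ c → rank s x + c) (trans (cnt-∷ (_<ᵇ x) z []) (ℕₚ.+-identityʳ _)))

≮⇒<ᵇ≡false : ∀ {m n} → ¬ m < n → (m <ᵇ n) ≡ false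
≮⇒<ᵇ≡false {m} {n} m≮n = dec-false (m ℕₚ.<? n) m≮n

<⇒<ᵇ≡true : ∀ {m n} → m < n → (m <ᵇ n) ≡ true
<⇒<ᵇ≡true {m} {n} m<n = Equivalence.to T-≡ (ℕₚ.<⇒<ᵇ m<n)

rank-∷ʳ-≤ : ∀ s {z x} → x ≤ z → rank (s ++ [ z ]) x ≡ rank s x
rank-∷ʳ-≤ s {z} {x} x≤z = trans (rank-∷ʳ s z x)
  (trans (cong (λ b → rank s x + bit b) (≮⇒<ᵇ≡false (ℕₚ.≤⇒≯ x≤z))) (ℕₚ.+-identityʳ _))

rank-all : ∀ {s z} → All (_< z) s → rank s z ≡ length s
rank-all {s} {z} s<z = cong length (filter-all _ (All.map ℕₚ.<⇒<ᵇ s<z))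

std-∷ʳ : ∀ {s z} → All (_< z) s → std (s ++ [ z ]) ≡ std s ++ [ length s ]
std-∷ʳ {s} {z} s<z = trans (map-++ _ s [ z ])
  (cong₂ (λ u v → u ++ [ v ])
    (map-cong-local (All.map (λ x<z → rank-∷ʳ-≤ s (ℕₚ.<⇒≤ x<z)) s<z))
    (trans (rank-∷ʳ-≤ s ℕₚ.≤-refl) (rank-all s<z)))

-- The last rank equals `length s`, so filtering `s` by `< z` discards nothing.
std-∷ʳ-inv : ∀ s z {u} → std (s ++ [ z ]) ≡ u ++ [ length u ] → All (_< z) s
std-∷ʳ-inv s z {u} eq = All.map (ℕₚ.<ᵇ⇒< _ _) (subst (All (T ∘ (_<ᵇ z))) (filter-complete _ full) (Allₚ.all-filter _ s))
  where
  parts = ∷ʳ-injective _ u (trans (sym (map-++ _ s [ z ])) eq)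
  full : rank s z ≡ length s
  full = trans (sym (rank-∷ʳ-≤ s ℕₚ.≤-refl)) (trans (proj₂ parts)
    (trans (cong length (sym (proj₁ parts))) (length-map _ s)))

-- As `k` is the largest entry, the standardization of `τ ++ [ k ]` ends in the largest possible
-- rank, and this forces `z` above all of `s`. The Boolean form can be rewritten under a count.
hasType-∷ʳ : ∀ {τ k} → All (_< k) τ → ∀ s z →
  hasType (τ ++ [ k ]) (s ++ [ z ]) ≡ hasType τ s ∧ all (_<ᵇ z) s
hasType-∷ʳ {τ} {k} τ<k s z with all (_<ᵇ z) s in eq
... | true  = trans (isYes≗does (std (s ++ [ z ]) ≟ std (τ ++ [ k ])))
    (trans (does-⇔ (mk⇔ to from) (std (s ++ [ z ]) ≟ std (τ ++ [ k ])) (std s ≟ std τ))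
    (trans (sym (isYes≗does (std s ≟ std τ))) (sym (∧-identityʳ _))))
  where
  _≟_ = ≡-dec ℕₚ._≟_
  s<z : All (_< z) s
  s<z = All.map (ℕₚ.<ᵇ⇒< _ _) (Allₚ.all⁺ (_<ᵇ z) s (Equivalence.from T-≡ eq))
  to : std (s ++ [ z ]) ≡ std (τ ++ [ k ]) → std s ≡ std τ
  to e = proj₁ (∷ʳ-injective _ _ (trans (sym (std-∷ʳ s<z)) (trans e (std-∷ʳ τ<k))))
  from : std s ≡ std τ → std (s ++ [ z ]) ≡ std (τ ++ [ k ])
  from e = trans (std-∷ʳ s<z) (trans (cong₂ (λ u l → u ++ [ l ]) e
    (trans (sym (length-map _ s)) (trans (cong length e) (length-map _ τ)))) (sym (std-∷ʳ τ<k)))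
... | false = trans (isYes≗does (std (s ++ [ z ]) ≟ std (τ ++ [ k ])))
    (trans (dec-false (std (s ++ [ z ]) ≟ std (τ ++ [ k ])) differ) (sym (∧-zeroʳ _)))
  where
  _≟_ = ≡-dec ℕₚ._≟_
  differ : std (s ++ [ z ]) ≢ std (τ ++ [ k ])
  differ e = subst T eq (Allₚ.all⁻ (_<ᵇ z) (All.map ℕₚ.<⇒<ᵇ
    (std-∷ʳ-inv s z (trans e (trans (std-∷ʳ τ<k) (cong (λ l → std τ ++ [ l ]) (sym (length-map _ τ))))))))

-- The last entry of an occurrence of τ,k at z is preceded by an occurrence of τ among the smaller entries.
occ-∷ʳ : ∀ {τ k} → All (_< k) τ → ∀ p z →
  occ (τ ++ [ k ]) (p ++ [ z ]) ≡ occ (τ ++ [ k ]) p + occ τ (filterᵇ (_<ᵇ z) p)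
occ-∷ʳ {τ} {k} τ<k p z = trans (cnt-subseqs-∷ʳ (hasType (τ ++ [ k ])) p z)
  (cong (λ c → occ (τ ++ [ k ]) p + c)
    (trans (cnt-cong (λ s → hasType-∷ʳ τ<k s z) (subseqs p)) (cnt-subseqs-filter (hasType τ) (_<ᵇ z) p)))

-- The occurrences of τ,k in p q whose last entry lies in q.
occAfter : List ℕ → List ℕ → List ℕ → ℕ
occAfter τ p []      = 0
occAfter τ p (z ∷ q) = occ τ (filterᵇ (_<ᵇ z) p) + occAfter τ (p ++ [ z ]) q

occ-++ : ∀ {τ k} → All (_< k) τ → ∀ p q → occ (τ ++ [ k ]) (p ++ q) ≡ occ (τ ++ [ k ]) p + occAfter τ p q
occ-++ {τ} {k} τ<k p []      = trans (cong (occ (τ ++ [ k ])) (++-identityʳ p)) (sym (ℕₚ.+-identityʳ _))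
occ-++ {τ} {k} τ<k p (z ∷ q) = trans (cong (occ (τ ++ [ k ])) (sym (++-assoc p [ z ] q)))
  (trans (occ-++ τ<k (p ++ [ z ]) q)
  (trans (cong (λ c → c + occAfter τ (p ++ [ z ]) q) (occ-∷ʳ τ<k p z)) (ℕₚ.+-assoc (occ (τ ++ [ k ]) p) _ _)))

-- Only the entries of the prefix below some later `z` matter. This is what allows the prefix up to
-- the maximum to be exchanged for a single entry.
occAfter-cong : ∀ τ {p p′} q → All (λ z → filterᵇ (_<ᵇ z) p ≡ filterᵇ (_<ᵇ z) p′) q → occAfter τ p q ≡ occAfter τ p′ q
occAfter-cong τ []      _ = refl
occAfter-cong τ {p} {p′} (z ∷ q) (eq ∷ eqs) = cong₂ (λ l c → occ τ l + c) eq
  (occAfter-cong τ q (All.map (λ {y} e → trans (filter-++ _ p [ z ])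
    (trans (cong (_++ filterᵇ (_<ᵇ y) [ z ]) e) (sym (filter-++ _ p′ [ z ])))) eqs))

-- The class of 1243- and 2143-avoiding permutations

∈-subseqs⁺ : ∀ {s xs} → s ⊆ xs → s ∈ subseqs xs
∈-subseqs⁺ []                 = here refl
∈-subseqs⁺ {xs = x ∷ xs} (.x ∷ʳ s⊆)   = ∈-++⁺ʳ (map (x ∷_) (subseqs xs)) (∈-subseqs⁺ s⊆)
∈-subseqs⁺ {xs = x ∷ xs} (refl ∷ s⊆) = ∈-++⁺ˡ (∈-map⁺ (x ∷_) (∈-subseqs⁺ s⊆))

∈-subseqs⁻ : ∀ {s} xs → s ∈ subseqs xs → s ⊆ xs
∈-subseqs⁻ []       (here refl) = []
∈-subseqs⁻ (x ∷ xs) s∈ with ∈-++⁻ (map (x ∷_) (subseqs xs)) s∈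
... | inj₂ s∈′ = x ∷ʳ ∈-subseqs⁻ xs s∈′
... | inj₁ s∈′ with _ , t∈ , refl ← map∷⁻ s∈′ = refl ∷ ∈-subseqs⁻ xs t∈

avoids⁺ : ∀ σ π → (∀ {s} → s ⊆ π → std s ≢ std σ) → occ σ π ≡ 0
avoids⁺ σ π none = cong length (filter-none _ (All.tabulate λ {s} s∈ t →
  none (∈-subseqs⁻ π s∈) (toWitness t)))

avoids⁻ : ∀ σ π → occ σ π ≡ 0 → ∀ {s} → s ⊆ π → std s ≢ std σ
avoids⁻ σ π none s⊆ eq = ℕₚ.n≮0 (subst (0 <_) none
  (filter-some _ (lose (∈-subseqs⁺ s⊆) (fromWitness eq))))

rank-∷ : ∀ y a x → rank (y ∷ a) x ≡ bit (y <ᵇ x) + rank a x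
rank-∷ y a x = cnt-∷ (_<ᵇ x) y a

bit-mono : ∀ z {x y} → x ≤ y → bit (z <ᵇ x) ≤ bit (z <ᵇ y)
bit-mono z {x} {y} x≤y with z ℕₚ.<? x
... | yes z<x rewrite <⇒<ᵇ≡true z<x | <⇒<ᵇ≡true (ℕₚ.<-≤-trans z<x x≤y) = ℕₚ.≤-refl
... | no  z≮x rewrite ≮⇒<ᵇ≡false z≮x = z≤n

rank-mono-≤ : ∀ a {x y} → x ≤ y → rank a x ≤ rank a y
rank-mono-≤ []      x≤y = z≤n
rank-mono-≤ (z ∷ a) {x} {y} x≤y rewrite rank-∷ z a x | rank-∷ z a y =
  ℕₚ.+-mono-≤ (bit-mono z x≤y) (rank-mono-≤ a x≤y)

rank-cancel-< : ∀ a {x y} → rank a x < rank a y → x < y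
rank-cancel-< a lt = ℕₚ.≰⇒> (λ y≤x → ℕₚ.<⇒≱ lt (rank-mono-≤ a y≤x))

rank-mono-⊆ : ∀ {s a} → s ⊆ a → ∀ x → rank s x ≤ rank a x
rank-mono-⊆ s⊆a x = length-mono-≤ (filter-mono _ _ (λ { refl → id }) s⊆a)

-- Ranks start at 0, so the two patterns standardize to 0 1 3 2 and 1 0 3 2; the bounds on `i` and
-- `j` treat both at once.
std-descent⁻ : ∀ {a b d c i j} → i < 2 → j < 2 → std (a ∷ b ∷ d ∷ c ∷ []) ≡ i ∷ j ∷ 3 ∷ 2 ∷ [] →
  a < c × b < c × c < d
std-descent⁻ {a} {b} {d} {c} i<2 j<2 eq =
    below (subst₂ _<_ (sym ea) (sym ec) i<2)
  , below (subst₂ _<_ (sym eb) (sym ec) j<2)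
  , below (subst₂ _<_ (sym ec) (sym ed) ℕₚ.≤-refl)
  where
  below = rank-cancel-< (a ∷ b ∷ d ∷ c ∷ [])
  ea = ∷-injectiveˡ eq
  eb = ∷-injectiveˡ (∷-injectiveʳ eq)
  ed = ∷-injectiveˡ (∷-injectiveʳ (∷-injectiveʳ eq))
  ec = ∷-injectiveˡ (∷-injectiveʳ (∷-injectiveʳ (∷-injectiveʳ eq)))

std-descent⁺ : ∀ {a b d c} → a < b → b < c → c < d →
  std (a ∷ b ∷ d ∷ c ∷ []) ≡ 0 ∷ 1 ∷ 3 ∷ 2 ∷ [] × std (b ∷ a ∷ d ∷ c ∷ []) ≡ 1 ∷ 0 ∷ 3 ∷ 2 ∷ []
std-descent⁺ {a} {b} {d} {c} a<b b<c c<d =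
  list (trans (rank₄ a b d c a) (bits (irrefl a) (no< a≤b) (no< a≤d) (no< a≤c)))
       (trans (rank₄ a b d c b) (bits (<⇒<ᵇ≡true a<b) (irrefl b) (no< b≤d) (no< b≤c)))
       (trans (rank₄ a b d c d) (bits (<⇒<ᵇ≡true a<d) (<⇒<ᵇ≡true b<d) (irrefl d) (<⇒<ᵇ≡true c<d)))
       (trans (rank₄ a b d c c) (bits (<⇒<ᵇ≡true a<c) (<⇒<ᵇ≡true b<c) (no< c≤d) (irrefl c)))
  ,
  list (trans (rank₄ b a d c b) (bits (irrefl b) (<⇒<ᵇ≡true a<b) (no< b≤d) (no< b≤c)))
       (trans (rank₄ b a d c a) (bits (no< a≤b) (irrefl a) (no< a≤d) (no< a≤c)))
       (trans (rank₄ b a d c d) (bits (<⇒<ᵇ≡true b<d) (<⇒<ᵇ≡true a<d) (irrefl d) (<⇒<ᵇ≡true c<d)))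
       (trans (rank₄ b a d c c) (bits (<⇒<ᵇ≡true b<c) (<⇒<ᵇ≡true a<c) (no< c≤d) (irrefl c)))
  where
  a<c = ℕₚ.<-trans a<b b<c
  b<d = ℕₚ.<-trans b<c c<d
  a<d = ℕₚ.<-trans a<b b<d
  a≤b = ℕₚ.<⇒≤ a<b
  a≤c = ℕₚ.<⇒≤ a<c
  a≤d = ℕₚ.<⇒≤ a<d
  b≤c = ℕₚ.<⇒≤ b<c
  b≤d = ℕₚ.<⇒≤ b<d
  c≤d = ℕₚ.<⇒≤ c<d
  no< : ∀ {x y} → x ≤ y → (y <ᵇ x) ≡ false
  no< x≤y = ≮⇒<ᵇ≡false (ℕₚ.≤⇒≯ x≤y)
  irrefl : ∀ x → (x <ᵇ x) ≡ false
  irrefl x = no< (ℕₚ.≤-refl {x})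
  rank₄ : ∀ p q r s x → rank (p ∷ q ∷ r ∷ s ∷ []) x
    ≡ bit (p <ᵇ x) + (bit (q <ᵇ x) + (bit (r <ᵇ x) + (bit (s <ᵇ x) + 0)))
  rank₄ p q r s x rewrite rank-∷ p (q ∷ r ∷ s ∷ []) x | rank-∷ q (r ∷ s ∷ []) x
    | rank-∷ r (s ∷ []) x | rank-∷ s [] x = refl
  bits : ∀ {p q r s p′ q′ r′ s′} → p ≡ p′ → q ≡ q′ → r ≡ r′ → s ≡ s′ →
    bit p + (bit q + (bit r + (bit s + 0))) ≡ bit p′ + (bit q′ + (bit r′ + (bit s′ + 0)))
  bits refl refl refl refl = refl
  list : ∀ {p q r s p′ q′ r′ s′ : ℕ} → p ≡ p′ → q ≡ q′ → r ≡ r′ → s ≡ s′ →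
    _≡_ {A = List ℕ} (p ∷ q ∷ r ∷ s ∷ []) (p′ ∷ q′ ∷ r′ ∷ s′ ∷ [])
  list refl refl refl refl = refl

length-4-inv : ∀ (s : List ℕ) {i j k l : ℕ} → std s ≡ i ∷ j ∷ k ∷ l ∷ [] →
  ∃ λ a → ∃ λ b → ∃ λ d → ∃ λ c → s ≡ a ∷ b ∷ d ∷ c ∷ []
length-4-inv s eq = go s (trans (sym (length-map _ s)) (cong length eq))
  where
  go : ∀ (s : List ℕ) → length s ≡ 4 → ∃ λ a → ∃ λ b → ∃ λ d → ∃ λ c → s ≡ a ∷ b ∷ d ∷ c ∷ []
  go (a ∷ b ∷ d ∷ c ∷ []) refl = a , b , d , c , refl

-- The patterns 1243 and 2143 differ only in the order of their first two entries. For distinct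
-- entries, avoiding both means that no descent `d c` is preceded by two entries below `c`, in
-- whatever order these come.
NoDescentAboveTwo : List ℕ → Set
NoDescentAboveTwo π = ∀ {a b d c} → a ∷ b ∷ d ∷ c ∷ [] ⊆ π → a < c → b < c → ¬ c < d

unique-⊆ : ∀ {a b : ℕ} {s xs} → Unique xs → a ∷ b ∷ s ⊆ xs → a ≢ b
unique-⊆ (_ ∷ u)  (_ ∷ʳ s⊆)   = unique-⊆ u s⊆
unique-⊆ (x∉ ∷ u) (refl ∷ s⊆) = All.head (All-resp-⊆ s⊆ x∉)

inClass⇒noDescent : ∀ {π} → Unique π → T (inClassᵇ π) → NoDescentAboveTwo π
inClass⇒noDescent {π} u t {a} {b} s⊆ a<c b<c c<d with Equivalence.to T-∧ t | ℕₚ.<-cmp a b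
... | t₁ , t₂ | tri< a<b _ _ = avoids⁻ p1243 π (ℕₚ.≡ᵇ⇒≡ _ _ t₁) s⊆ (proj₁ (std-descent⁺ a<b b<c c<d))
... | t₁ , t₂ | tri≈ _ a≡b _ = unique-⊆ u s⊆ a≡b
... | t₁ , t₂ | tri> _ _ b<a = avoids⁻ p2143 π (ℕₚ.≡ᵇ⇒≡ _ _ t₂) s⊆ (proj₂ (std-descent⁺ b<a a<c c<d))

noDescent⇒inClass : ∀ {π} → NoDescentAboveTwo π → T (inClassᵇ π)
noDescent⇒inClass {π} none = Equivalence.from T-∧
  (ℕₚ.≡⇒≡ᵇ _ _ (avoids⁺ p1243 π (λ s⊆ → absurd (s≤s z≤n) (s≤s (s≤s z≤n)) s⊆))
  , ℕₚ.≡⇒≡ᵇ _ _ (avoids⁺ p2143 π (λ s⊆ → absurd (s≤s (s≤s z≤n)) (s≤s z≤n) s⊆)))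
  where
  absurd : ∀ {i j} → i < 2 → j < 2 → ∀ {s} → s ⊆ π → std s ≢ i ∷ j ∷ 3 ∷ 2 ∷ []
  absurd i<2 j<2 {s} s⊆ eq with length-4-inv s eq
  ... | _ , _ , _ , _ , refl with std-descent⁻ i<2 j<2 eq
  ...   | a<c , b<c , c<d = none s⊆ a<c b<c c<d

-- p has been read and the second argument is still to be read; d plays the role of the 4, c that of the 3.
InClassAfter : List ℕ → List ℕ → Set
InClassAfter p []      = ⊤
InClassAfter p (d ∷ q) = All (λ c → c < d → rank p c ≤ 1) q × InClassAfter (p ++ [ d ]) q

⊆-++⁻ : ∀ (xs : List ℕ) {ys zs} → xs ++ ys ⊆ zs → ∃₂ λ u v → zs ≡ u ++ v × xs ⊆ u × ys ⊆ v
⊆-++⁻ []       s⊆ = [] , _ , refl , [] , s⊆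
⊆-++⁻ (x ∷ xs) (y ∷ʳ s⊆) with u , v , refl , p , q ← ⊆-++⁻ (x ∷ xs) s⊆ = y ∷ u , v , refl , y ∷ʳ p , q
⊆-++⁻ (x ∷ xs) (refl ∷ s⊆) with u , v , refl , p , q ← ⊆-++⁻ xs s⊆ = x ∷ u , v , refl , refl ∷ p , q

inClassAfter-++⁻ʳ : ∀ p u v → InClassAfter p (u ++ v) → InClassAfter (p ++ u) v
inClassAfter-++⁻ʳ p []      v ic       = subst (λ p → InClassAfter p v) (sym (++-identityʳ p)) ic
inClassAfter-++⁻ʳ p (x ∷ u) v (_ , ic) =
  subst (λ p → InClassAfter p v) (++-assoc p [ x ] u) (inClassAfter-++⁻ʳ (p ++ [ x ]) u v ic)

-- When the reading arrives at `d`, both `a` and `b` are in the prefix and below `c`, so `c` has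
-- rank at least 2 there.
inClassAfter⇒noDescent : ∀ {π} → InClassAfter [] π → NoDescentAboveTwo π
inClassAfter⇒noDescent ic {a} {b} {d} {c} s⊆ a<c b<c c<d
  with u , v , refl , p , q ← ⊆-++⁻ (a ∷ b ∷ []) s⊆ = go u v (inClassAfter-++⁻ʳ [] u v ic) p q
  where
  go : ∀ u v → InClassAfter u v → a ∷ b ∷ [] ⊆ u → d ∷ c ∷ [] ⊆ v → ⊥
  go u (x ∷ v) (_ , ic) p (.x ∷ʳ q) = go (u ++ [ x ]) v ic (⊆-trans p (++-⊆ˡ u)) q
    where
    ++-⊆ˡ : ∀ u → u ⊆ u ++ [ x ]
    ++-⊆ˡ u = subst (_⊆ u ++ [ x ]) (++-identityʳ u) (++-⊆ ⊆-refl (minimum [ x ]))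
  go u (x ∷ v) (small , _) p (refl ∷ q) = ℕₚ.<⇒≱ {1} {2} ℕₚ.≤-refl
    (ℕₚ.≤-trans (subst (_≤ rank u c) (rank-all (a<c ∷ b<c ∷ [])) (rank-mono-⊆ p c))
                (All.lookup small (to∈ q) c<d))

two-smaller : ∀ p {c} → ¬ rank p c ≤ 1 → ∃₂ λ a b → a ∷ b ∷ [] ⊆ p × a < c × b < c
two-smaller p {c} big with filterᵇ (_<ᵇ c) p | filter-⊆ (λ x → T? (x <ᵇ c)) p | Allₚ.all-filter (λ x → T? (x <ᵇ c)) p
... | []        | _ | _ = ⊥-elim (big z≤n)
... | _ ∷ []    | _ | _ = ⊥-elim (big (s≤s z≤n))
... | a ∷ b ∷ l | s⊆ | ta ∷ tb ∷ _ = a , b , ⊆-trans (refl ∷ refl ∷ minimum l) s⊆ , ℕₚ.<ᵇ⇒< a c ta , ℕₚ.<ᵇ⇒< b c tb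

noDescent⇒inClassAfter : ∀ p q → NoDescentAboveTwo (p ++ q) → InClassAfter p q
noDescent⇒inClassAfter p []      none = tt
noDescent⇒inClassAfter p (d ∷ q) none =
  All.tabulate (λ {c} c∈q c<d → decidable-stable (rank p c ℕₚ.≤? 1) (λ big →
    let (a , b , s⊆ , a<c , b<c) = two-smaller p big in
    none (++-⊆ s⊆ (refl ∷ from∈ c∈q)) a<c b<c c<d))
  , noDescent⇒inClassAfter (p ++ [ d ]) q (subst NoDescentAboveTwo (sym (++-assoc p [ d ] q)) none)

inClass⇔ : ∀ {π} → Unique π → T (inClassᵇ π) ⇔ InClassAfter [] π
inClass⇔ u = mk⇔ (λ t → noDescent⇒inClassAfter [] _ (inClass⇒noDescent u t))
                 (λ ic → noDescent⇒inClass (inClassAfter⇒noDescent ic))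

-- The counterpart of `occAfter-cong` for the class condition: here the prefix matters only through
-- the ranks of the entries still to come.
inClassAfter-cong : ∀ {p p′} q → All (λ c → rank p c ≡ rank p′ c) q → InClassAfter p q → InClassAfter p′ q
inClassAfter-cong []      _ _ = tt
inClassAfter-cong {p} {p′} (d ∷ q) (_ ∷ eqs) (small , ic) =
  All.zipWith (λ (eq , le) c<d → subst (_≤ 1) eq (le c<d)) (eqs , small)
  , inClassAfter-cong q (All.map (λ {c} eq → trans (rank-∷ʳ p d c)
      (trans (cong (_+ bit (d <ᵇ c)) eq) (sym (rank-∷ʳ p′ d c)))) eqs) ic

-- For a descent from `u` into `v`, the rank of `c` in all of `p ++ u` bounds its rank in the part
-- read before `d`.
inClassAfter-++ : ∀ p u v → (∀ {d c} → d ∈ u → c ∈ v → c < d → rank (p ++ u) c ≤ 1) →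
  InClassAfter p u → InClassAfter (p ++ u) v → InClassAfter p (u ++ v)
inClassAfter-++ p []      v small icu icv = subst (λ p → InClassAfter p v) (++-identityʳ p) icv
inClassAfter-++ p (x ∷ u) v small (sm , icu) icv =
  Allₚ.++⁺ sm (All.tabulate λ {c} c∈v c<x → ℕₚ.≤-trans (rank-mono-⊆ p⊆ c) (small (here refl) c∈v c<x))
  , inClassAfter-++ (p ++ [ x ]) u v
      (λ {_} {c} d∈ c∈ c<d → subst (λ p → rank p c ≤ 1) (sym (++-assoc p [ x ] u)) (small (there d∈) c∈ c<d)) icu
      (subst (λ p → InClassAfter p v) (sym (++-assoc p [ x ] u)) icv)
  where
  p⊆ : p ⊆ p ++ x ∷ u
  p⊆ = subst (_⊆ p ++ x ∷ u) (++-identityʳ p) (++-⊆ ⊆-refl (minimum _))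

inClassAfter-++⁻ˡ : ∀ p u v → InClassAfter p (u ++ v) → InClassAfter p u
inClassAfter-++⁻ˡ p []      v ic        = tt
inClassAfter-++⁻ˡ p (x ∷ u) v (sm , ic) = Allₚ.++⁻ˡ u sm , inClassAfter-++⁻ˡ (p ++ [ x ]) u v ic

-- Gluing two permutations

applyUpTo-+ : ∀ {A : Set} (f : ℕ → A) m n → applyUpTo f (m + n) ≡ applyUpTo f m ++ applyUpTo (λ i → f (m + i)) n
applyUpTo-+ f zero    n = refl
applyUpTo-+ f (suc m) n = cong (f 0 ∷_) (applyUpTo-+ (f ∘ suc) m n)

oneTo-+ : ∀ m n → oneTo (m + n) ≡ oneTo m ++ applyUpTo (λ i → suc (m + i)) n
oneTo-+ = applyUpTo-+ suc

∈-oneTo⁻ : ∀ {n x} → x ∈ oneTo n → 1 ≤ x × x ≤ n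
∈-oneTo⁻ x∈ with _ , i<n , refl ← ∈-applyUpTo⁻ suc x∈ = s≤s z≤n , i<n

oneTo-suc-↭ : ∀ n → oneTo (suc n) ↭ suc n ∷ oneTo n
oneTo-suc-↭ n = ↭-trans (↭-reflexive (sym (applyUpTo-∷ʳ suc n))) (++-comm (oneTo n) [ suc n ])

filter-<-all : ∀ {z xs} → All (_< z) xs → filterᵇ (_<ᵇ z) xs ≡ xs
filter-<-all {z} xs<z = filter-all (λ x → T? (x <ᵇ z)) (All.map ℕₚ.<⇒<ᵇ xs<z)

filter-<-none : ∀ {z xs} → All (z ≤_) xs → filterᵇ (_<ᵇ z) xs ≡ []
filter-<-none {z} z≤xs = filter-none (λ x → T? (x <ᵇ z)) (All.map (λ {x} z≤x t → ℕₚ.<⇒≱ (ℕₚ.<ᵇ⇒< x z t) z≤x) z≤xs)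

filter-oneTo : ∀ m n → filterᵇ (_<ᵇ suc m) (oneTo (m + n)) ≡ oneTo m
filter-oneTo m n = begin
  filterᵇ (_<ᵇ suc m) (oneTo (m + n))
    ≡⟨ cong (filterᵇ (_<ᵇ suc m)) (oneTo-+ m n) ⟩
  filterᵇ (_<ᵇ suc m) (oneTo m ++ rest)
    ≡⟨ filter-++ _ (oneTo m) rest ⟩
  filterᵇ (_<ᵇ suc m) (oneTo m) ++ filterᵇ (_<ᵇ suc m) rest
    ≡⟨ cong₂ _++_
         (filter-<-all (All.tabulate (λ x∈ → s≤s (proj₂ (∈-oneTo⁻ x∈)))))
         (filter-<-none (Allₚ.applyUpTo⁺₂ _ n (λ i → s≤s (ℕₚ.m≤m+n m i)))) ⟩
  oneTo m ++ []
    ≡⟨ ++-identityʳ (oneTo m) ⟩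
  oneTo m ∎
  where
  open ≡-Reasoning
  rest = applyUpTo (λ i → suc (m + i)) n

rank-oneTo : ∀ n {x} → x ∈ oneTo n → suc (rank (oneTo n) x) ≡ x
rank-oneTo n x∈ with i , i<n , refl ← ∈-applyUpTo⁻ suc x∈ = cong suc (begin
  rank (oneTo n) (suc i)              ≡⟨ cong (λ n → rank (oneTo n) (suc i)) (ℕₚ.m+[n∸m]≡n (ℕₚ.<⇒≤ i<n)) ⟨
  rank (oneTo (i + (n ∸ i))) (suc i)  ≡⟨ cong length (filter-oneTo i (n ∸ i)) ⟩
  length (oneTo i)                    ≡⟨ length-applyUpTo suc i ⟩
  i                                   ∎)
  where open ≡-Reasoning

↭-++-cancelˡ : ∀ {A : Set} (xs : List A) {ys zs} → xs ++ ys ↭ xs ++ zs → ys ↭ zs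
↭-++-cancelˡ []       p = p
↭-++-cancelˡ (x ∷ xs) p = ↭-++-cancelˡ xs (drop-∷ p)

partition-↭ : ∀ {A : Set} (p : A → Bool) xs → xs ↭ filterᵇ p xs ++ filterᵇ (not ∘ p) xs
partition-↭ p []       = ↭-refl
partition-↭ p (x ∷ xs) with p x
... | true  = prep x (partition-↭ p xs)
... | false = ↭-trans (prep x (partition-↭ p xs)) (↭-sym (shift x (filterᵇ p xs) _))

Increasing : (ℕ → ℕ) → Set
Increasing f = ∀ {x y} → x < y → f x < f y

increasing⇒strictlyMonotone : ∀ {f} → Increasing f → StrictlyMonotone f
increasing⇒strictlyMonotone {f} inc x y with ℕₚ.<-cmp x y
... | tri< x<y _ _  = trans (<⇒<ᵇ≡true (inc x<y)) (sym (<⇒<ᵇ≡true x<y))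
... | tri≈ x≮x refl _ = trans (≮⇒<ᵇ≡false (ℕₚ.n≮n (f x))) (sym (≮⇒<ᵇ≡false x≮x))
... | tri> x≮y _ y<x = trans (≮⇒<ᵇ≡false (ℕₚ.<-asym (inc y<x))) (sym (≮⇒<ᵇ≡false x≮y))

increasing⇒injective : ∀ {f} → Increasing f → ∀ {x y} → f x ≡ f y → x ≡ y
increasing⇒injective inc {x} {y} eq with ℕₚ.<-cmp x y
... | tri< x<y _ _ = ⊥-elim (ℕₚ.<⇒≢ (inc x<y) eq)
... | tri≈ _ x≡y _ = x≡y
... | tri> _ _ y<x = ⊥-elim (ℕₚ.<⇒≢ (inc y<x) (sym eq))

-- The values of the prefix of a glued permutation: 1 ↦ s, and 2, 3, … ↦ l + 1, l + 2, ….
-- The value at 0 only serves to make the map increasing on all of ℕ.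
spread : ℕ → ℕ → ℕ → ℕ
spread s l zero          = 0
spread s l (suc zero)    = s
spread s l (suc (suc v)) = suc (l + v)

spread-increasing : ∀ {s l} → 1 ≤ s → s ≤ l → Increasing (spread s l)
spread-increasing 1≤s s≤l {zero}        {suc zero}    _ = 1≤s
spread-increasing 1≤s s≤l {zero}        {suc (suc y)} _ = s≤s z≤n
spread-increasing 1≤s s≤l {suc zero}    {suc zero}    (s≤s ())
spread-increasing 1≤s s≤l {suc zero}    {suc (suc y)} _ = s≤s (ℕₚ.≤-trans s≤l (ℕₚ.m≤m+n _ y))
spread-increasing 1≤s s≤l {suc (suc x)} {suc zero}    (s≤s ())
spread-increasing {l = l} 1≤s s≤l {suc (suc x)} {suc (suc y)} (s≤s (s≤s x<y)) = s≤s (ℕₚ.+-monoʳ-< l x<y)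

IsPermutation : List ℕ → Set
IsPermutation π = π ↭ oneTo (length π)

-- The hypothesis `below` isolates what is used about the prefix: seen from a value up to `l`, it is
-- indistinguishable from the single entry `s`. `Glue.f-below` supplies it for glued permutations.
module _ {π₁ π₂ N s l} (π₁<N : All (_< N) π₁) (π₂≤l : All (_≤ l) π₂) (l<N : l < N)
         (below : ∀ {z} → z ≤ l → filterᵇ (_<ᵇ z) π₁ ≡ filterᵇ (_<ᵇ z) [ s ]) where

  filter-prefix : All (λ z → filterᵇ (_<ᵇ z) (π₁ ++ [ N ]) ≡ filterᵇ (_<ᵇ z) [ s ]) π₂
  filter-prefix = All.map (λ {z} z≤l → trans (filter-++ _ π₁ [ N ])
    (trans (cong₂ _++_ (below z≤l)
        (filter-<-none (ℕₚ.<⇒≤ (ℕₚ.≤-<-trans z≤l l<N) ∷ [])))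
      (++-identityʳ _))) π₂≤l

  occ-around-max : ∀ {t τ k} → All (_< k) (t ∷ τ) →
    occ (t ∷ τ ++ [ k ]) (π₁ ++ N ∷ π₂)
      ≡ occ (t ∷ τ ++ [ k ]) π₁ + occ (t ∷ τ) π₁ + occ (t ∷ τ ++ [ k ]) (s ∷ π₂)
  occ-around-max {t} {τ} {k} τ<k = begin
    occ τk (π₁ ++ N ∷ π₂)
      ≡⟨ occ-++ τ<k π₁ (N ∷ π₂) ⟩
    occ τk π₁ + (occ (t ∷ τ) (filterᵇ (_<ᵇ N) π₁) + occAfter (t ∷ τ) (π₁ ++ [ N ]) π₂)
      ≡⟨ cong₂ (λ u c → occ τk π₁ + (occ (t ∷ τ) u + c))
           (filter-<-all π₁<N) (occAfter-cong (t ∷ τ) π₂ filter-prefix) ⟩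
    occ τk π₁ + (occ (t ∷ τ) π₁ + occAfter (t ∷ τ) [ s ] π₂)
      ≡⟨ ℕₚ.+-assoc (occ τk π₁) _ _ ⟨
    occ τk π₁ + occ (t ∷ τ) π₁ + occAfter (t ∷ τ) [ s ] π₂
      -- Since the pattern is a cons, `occ τk []` and `occ (t ∷ τ) []` compute to 0, so reading `s`
      -- alone contributes nothing.
      ≡⟨ cong (λ c → occ τk π₁ + occ (t ∷ τ) π₁ + c) (occ-++ τ<k [] (s ∷ π₂)) ⟨
    occ τk π₁ + occ (t ∷ τ) π₁ + occ τk (s ∷ π₂) ∎
    where
    open ≡-Reasoning
    τk = t ∷ τ ++ [ k ]

  -- A descent lies inside π₁, or ends in π₂ after starting in π₁ or at `N`, where only `s` can be
  -- below its lower end, or lies inside π₂, where the prefix acts like `s`.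
  inClassAfter-around-max⁺ : InClassAfter [] π₁ → InClassAfter [] (s ∷ π₂) → InClassAfter [] (π₁ ++ N ∷ π₂)
  inClassAfter-around-max⁺ ic₁ (_ , ic₂) = inClassAfter-++ [] π₁ (N ∷ π₂) one-below ic₁
    ( All.map (λ z≤l _ → rank≤1 z≤l) π₂≤l
    , inClassAfter-cong π₂ (All.map (sym ∘ cong length) filter-prefix) ic₂)
    where
    rank≤1 : ∀ {z} → z ≤ l → rank π₁ z ≤ 1
    rank≤1 {z} z≤l = subst (_≤ 1) (sym (cong length (below z≤l))) (length-filter (λ x → T? (x <ᵇ z)) [ s ])
    one-below : ∀ {d c} → d ∈ π₁ → c ∈ N ∷ π₂ → c < d → rank π₁ c ≤ 1
    one-below d∈ (here refl) N<d = ⊥-elim (ℕₚ.<-asym N<d (All.lookup π₁<N d∈))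
    one-below d∈ (there c∈)  _   = rank≤1 (All.lookup π₂≤l c∈)

  inClassAfter-around-max⁻ : InClassAfter [] (π₁ ++ N ∷ π₂) → InClassAfter [] π₁ × InClassAfter [] (s ∷ π₂)
  inClassAfter-around-max⁻ ic =
    inClassAfter-++⁻ˡ [] π₁ (N ∷ π₂) ic ,
    ( All.tabulate (λ _ _ → z≤n)
    , inClassAfter-cong π₂ (All.map (cong length) filter-prefix) (proj₂ (inClassAfter-++⁻ʳ [] π₁ (N ∷ π₂) ic)))

-- Nothing precedes a leading maximum, so it cannot end an occurrence of the nonempty `t ∷ τ`
-- followed by `k`; and it is below no later entry.
occ-max-∷ : ∀ {t τ k N π} → All (_< k) (t ∷ τ) → All (_< N) π →
  occ (t ∷ τ ++ [ k ]) (N ∷ π) ≡ occ (t ∷ τ ++ [ k ]) π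
occ-max-∷ {t} {τ} {k} {N} {π} τ<k π<N = trans (occ-++ τ<k [] (N ∷ π))
  (trans (occAfter-cong (t ∷ τ) π (All.map N-ignored π<N)) (sym (occ-++ τ<k [] π)))
  where
  N-ignored : ∀ {z} → z < N → filterᵇ (_<ᵇ z) [ N ] ≡ []
  N-ignored {z} z<N = filter-<-none (ℕₚ.<⇒≤ z<N ∷ [])

inClassAfter-max-∷ : ∀ {N π} → All (_< N) π → InClassAfter [] (N ∷ π) ⇔ InClassAfter [] π
inClassAfter-max-∷ {N} {π} π<N = mk⇔
  (λ (_ , ic) → inClassAfter-cong π (All.map N-ignored π<N) ic)
  (λ ic → All.tabulate (λ _ _ → z≤n) , inClassAfter-cong π (All.map (sym ∘ N-ignored) π<N) ic)
  where
  N-ignored : ∀ {z} → z < N → rank [ N ] z ≡ 0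
  N-ignored {z} z<N = trans (rank-∷ N [] z) (cong (λ b → bit b + 0) (≮⇒<ᵇ≡false (ℕₚ.<-asym z<N)))

-- The `s` of the second permutation moves to the place of the 1 in `ρ`, and the new maximum is the
-- sum of the two lengths. The value at an empty second argument is a placeholder, as only nonempty
-- permutations are glued.
glue : List ℕ → List ℕ → List ℕ
glue ρ []      = []
glue ρ (s ∷ π) = map (spread s (suc (length π))) ρ ++ (suc (length π) + length ρ) ∷ π

module Glue {r ρ s π} (ρ-perm : IsPermutation (r ∷ ρ)) (σ-perm : IsPermutation (s ∷ π)) where

  private
    l = suc (length π)
    f = spread s l
    N = l + suc (length ρ)

    σ-range : ∀ {x} → x ∈ s ∷ π → 1 ≤ x × x ≤ l
    σ-range x∈ = ∈-oneTo⁻ (∈-resp-↭ σ-perm x∈)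

    π≤l : All (_≤ l) π
    π≤l = All.tabulate (proj₂ ∘ σ-range ∘ there)

    l<N : l < N
    l<N = ℕₚ.m<m+n l (s≤s z≤n)

    -- `N` is the value of `f` just beyond the largest entry of `r ∷ ρ`, so monotonicity alone puts
    -- `N` above the prefix.
    N≡spread : N ≡ f (suc (suc (length ρ)))
    N≡spread = ℕₚ.+-suc l (length ρ)

  f-increasing : Increasing f
  f-increasing = spread-increasing (proj₁ (σ-range (here refl))) (proj₂ (σ-range (here refl)))

  f<N : All (_< N) (map f (r ∷ ρ))
  f<N = Allₚ.map⁺ (All.tabulate λ {x} x∈ →
    subst (f x <_) (sym N≡spread) (f-increasing (s≤s (proj₂ (∈-oneTo⁻ (∈-resp-↭ ρ-perm x∈))))))

  -- Only the entry 1 is sent to a value up to `l`, namely `s`. Splitting at it, the parts on both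
  -- sides vanish under the filter.
  f-below : ∀ {z} → z ≤ l → filterᵇ (_<ᵇ z) (map f (r ∷ ρ)) ≡ filterᵇ (_<ᵇ z) [ s ]
  f-below {z} z≤l with u , v , eq ← ∈-∃++ (∈-resp-↭ (↭-sym ρ-perm) (here refl)) = begin
    filterᵇ (_<ᵇ z) (map f (r ∷ ρ))
      ≡⟨ cong (filterᵇ (_<ᵇ z) ∘ map f) eq ⟩
    filterᵇ (_<ᵇ z) (map f (u ++ 1 ∷ v))
      ≡⟨ cong (filterᵇ (_<ᵇ z)) (map-++ f u (1 ∷ v)) ⟩
    filterᵇ (_<ᵇ z) (map f u ++ [ s ] ++ map f v)
      ≡⟨ filter-++ _ (map f u) ([ s ] ++ map f v) ⟩
    filterᵇ (_<ᵇ z) (map f u) ++ filterᵇ (_<ᵇ z) ([ s ] ++ map f v)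
      ≡⟨ cong (filterᵇ (_<ᵇ z) (map f u) ++_) (filter-++ _ [ s ] (map f v)) ⟩
    filterᵇ (_<ᵇ z) (map f u) ++ filterᵇ (_<ᵇ z) [ s ] ++ filterᵇ (_<ᵇ z) (map f v)
      ≡⟨ cong₂ (λ a b → a ++ filterᵇ (_<ᵇ z) [ s ] ++ b) (none u (∈-++⁺ˡ)) (none v (∈-++⁺ʳ u)) ⟩
    filterᵇ (_<ᵇ z) [ s ] ++ []
      ≡⟨ ++-identityʳ _ ⟩
    filterᵇ (_<ᵇ z) [ s ] ∎
    where
    open ≡-Reasoning
    others : u ++ v ↭ applyUpTo (suc ∘ suc) (length ρ)
    others = drop-mid u [] (subst (_↭ oneTo (suc (length ρ))) eq ρ-perm)
    big : ∀ {x} → x ∈ u ++ v → z ≤ f x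
    big x∈ with j , _ , refl ← ∈-applyUpTo⁻ (suc ∘ suc) (∈-resp-↭ others x∈) =
      ℕₚ.≤-trans z≤l (ℕₚ.≤-trans (ℕₚ.m≤m+n l j) (ℕₚ.n≤1+n _))
    none : ∀ w → (∀ {x} → x ∈ w → x ∈ u ++ v) → filterᵇ (_<ᵇ z) (map f w) ≡ []
    none w w⊆ = filter-<-none (Allₚ.map⁺ (All.tabulate (big ∘ w⊆)))

  map-f-↭ : map f (r ∷ ρ) ↭ s ∷ applyUpTo (λ i → suc (l + i)) (length ρ)
  map-f-↭ = ↭-trans (map-↭ f ρ-perm)
    (↭-reflexive (cong (s ∷_) (map-applyUpTo (suc ∘ suc) f (length ρ))))

  glue-↭ : glue (r ∷ ρ) (s ∷ π) ↭ oneTo N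
  glue-↭ = begin
    map f (r ∷ ρ) ++ N ∷ π           ↭⟨ ++-↭ʳ (N ∷ π) map-f-↭ ⟩
    s ∷ A ++ [ N ] ++ π              ≡⟨ cong (s ∷_) (++-assoc A [ N ] π) ⟨
    s ∷ (A ++ [ N ]) ++ π            ↭⟨ prep s (++-comm (A ++ [ N ]) π) ⟩
    (s ∷ π) ++ A ++ [ N ]            ↭⟨ ++-↭ʳ (A ++ [ N ]) σ-perm ⟩
    oneTo l ++ A ++ [ N ]            ≡⟨ cong (λ x → oneTo l ++ A ++ [ x ]) N≡spread ⟩
    oneTo l ++ A ++ [ suc (l + length ρ) ]
      ≡⟨ cong (oneTo l ++_) (applyUpTo-∷ʳ (λ i → suc (l + i)) (length ρ)) ⟩
    oneTo l ++ applyUpTo (λ i → suc (l + i)) (suc (length ρ))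
      ≡⟨ oneTo-+ l (suc (length ρ)) ⟨
    oneTo N ∎
    where
    open PermutationReasoning
    A = applyUpTo (λ i → suc (l + i)) (length ρ)

  occ-glue : ∀ {t τ k} → All (_< k) (t ∷ τ) →
    occ (t ∷ τ ++ [ k ]) (glue (r ∷ ρ) (s ∷ π))
      ≡ occ (t ∷ τ ++ [ k ]) (r ∷ ρ) + occ (t ∷ τ) (r ∷ ρ) + occ (t ∷ τ ++ [ k ]) (s ∷ π)
  occ-glue {t} {τ} {k} τ<k = trans (occ-around-max f<N π≤l l<N f-below τ<k)
    (cong₂ (λ a b → a + b + occ (t ∷ τ ++ [ k ]) (s ∷ π))
      (occ-map mono (t ∷ τ ++ [ k ]) (r ∷ ρ)) (occ-map mono (t ∷ τ) (r ∷ ρ)))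
    where mono = increasing⇒strictlyMonotone f-increasing

  inClassᵇ-map-f : inClassᵇ (map f (r ∷ ρ)) ≡ inClassᵇ (r ∷ ρ)
  inClassᵇ-map-f = cong₂ (λ a b → (a ≡ᵇ 0) ∧ (b ≡ᵇ 0)) (occ-map mono p1243 (r ∷ ρ)) (occ-map mono p2143 (r ∷ ρ))
    where mono = increasing⇒strictlyMonotone f-increasing

-- The decomposition of the class at the maximum

unique-↭-oneTo : ∀ {n π} → π ↭ oneTo n → Unique π
unique-↭-oneTo {n} π-perm = Unique-resp-↭ (setoid ℕ) (↭⇒↭ₛ (↭-sym π-perm)) (unique-oneTo n)

++-∷-injective : ∀ {A : Set} {x : A} u u′ {v v′} → u ++ x ∷ v ≡ u′ ++ x ∷ v′ → x ∉ u → x ∉ u′ → u ≡ u′ × v ≡ v′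
++-∷-injective []      []        eq x∉u x∉u′ = refl , ∷-injectiveʳ eq
++-∷-injective []      (y ∷ u′)  eq x∉u x∉u′ = ⊥-elim (x∉u′ (here (∷-injectiveˡ eq)))
++-∷-injective (y ∷ u) []        eq x∉u x∉u′ = ⊥-elim (x∉u (here (sym (∷-injectiveˡ eq))))
++-∷-injective (y ∷ u) (y′ ∷ u′) eq x∉u x∉u′
  with refl , eq′ ← ∷-injective eq
  with refl , refl ← ++-∷-injective u u′ eq′ (x∉u ∘ there) (x∉u′ ∘ there) = refl , refl

module _ {r ρ s π} (ρ-perm : IsPermutation (r ∷ ρ)) (σ-perm : IsPermutation (s ∷ π)) where
  open Glue ρ-perm σ-perm

  private
    π≤l : All (_≤ suc (length π)) π
    π≤l = All.tabulate (λ x∈ → proj₂ (∈-oneTo⁻ (∈-resp-↭ σ-perm (there x∈))))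

    l<N : suc (length π) < suc (length π) + suc (length ρ)
    l<N = ℕₚ.m<m+n (suc (length π)) (s≤s z≤n)

    unique-f : Unique (map (spread s (suc (length π))) (r ∷ ρ))
    unique-f = Uniqueₚ.map⁺ (increasing⇒injective f-increasing) (unique-↭-oneTo ρ-perm)

    open Equivalence

  inClass-glue⁺ : T (inClassᵇ (r ∷ ρ)) → T (inClassᵇ (s ∷ π)) → T (inClassᵇ (glue (r ∷ ρ) (s ∷ π)))
  inClass-glue⁺ tρ tσ = from (inClass⇔ (unique-↭-oneTo glue-↭))
    (inClassAfter-around-max⁺ f<N π≤l l<N f-below
      (to (inClass⇔ unique-f) (subst T (sym inClassᵇ-map-f) tρ)) (to (inClass⇔ (unique-↭-oneTo σ-perm)) tσ))

  inClass-glue⁻ : T (inClassᵇ (glue (r ∷ ρ) (s ∷ π))) → T (inClassᵇ (r ∷ ρ)) × T (inClassᵇ (s ∷ π))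
  inClass-glue⁻ t =
    let (icρ , icσ) = inClassAfter-around-max⁻ f<N π≤l l<N f-below (to (inClass⇔ (unique-↭-oneTo glue-↭)) t)
    in subst T inClassᵇ-map-f (from (inClass⇔ unique-f) icρ) , from (inClass⇔ (unique-↭-oneTo σ-perm)) icσ

-- Both lists have the same sum, from which the sum of the common tail cancels.
∷-↭-injective : ∀ {x y : ℕ} {xs} → x ∷ xs ↭ y ∷ xs → x ≡ y
∷-↭-injective {x} {y} {xs} p = ℕₚ.+-cancelʳ-≡ (sum xs) x y (sum-↭ p)

-- The maximum occurs once and so marks the cut. What follows it is `π`, then `s` is the value
-- missing from `π`, and `ρ` is recovered because `spread` is injective.
glue-injective : ∀ {r ρ s π r′ ρ′ s′ π′} →
  IsPermutation (r ∷ ρ) → IsPermutation (s ∷ π) → IsPermutation (r′ ∷ ρ′) → IsPermutation (s′ ∷ π′) →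
  suc (length π) + suc (length ρ) ≡ suc (length π′) + suc (length ρ′) →
  glue (r ∷ ρ) (s ∷ π) ≡ glue (r′ ∷ ρ′) (s′ ∷ π′) → r ∷ ρ ≡ r′ ∷ ρ′ × s ∷ π ≡ s′ ∷ π′
glue-injective {r} {ρ} {s} {π} {r′} {ρ′} {s′} {π′} pρ pσ pρ′ pσ′ N≡N′ eq
  with eq₁ , refl ← ++-∷-injective (map _ (r ∷ ρ)) (map _ (r′ ∷ ρ′))
         (trans eq (cong (λ N → map (spread s′ (suc (length π′))) (r′ ∷ ρ′) ++ N ∷ π′) (sym N≡N′)))
         (λ N∈ → ℕₚ.n≮n _ (All.lookup (Glue.f<N pρ pσ) N∈))
         (λ N∈ → ℕₚ.<-irrefl N≡N′ (All.lookup (Glue.f<N pρ′ pσ′) N∈))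
  with refl ← ∷-↭-injective (↭-trans pσ (↭-sym pσ′)) =
  map-injective (increasing⇒injective (Glue.f-increasing pρ pσ)) eq₁ , refl

module _ {p π₁ π₂ n} (perm : p ∷ π₁ ++ suc n ∷ π₂ ↭ oneTo (suc n))
         (ic : InClassAfter [] (p ∷ π₁ ++ suc n ∷ π₂)) where

  private
    i = length π₁
    l = suc (length π₂)

  unglue-size : l + suc i ≡ suc n
  unglue-size = begin
    l + suc i                         ≡⟨ ℕₚ.+-comm l (suc i) ⟩
    suc i + l                         ≡⟨ length-++ (p ∷ π₁) ⟨
    length (p ∷ π₁ ++ suc n ∷ π₂)     ≡⟨ ↭-length perm ⟩
    length (oneTo (suc n))            ≡⟨ length-applyUpTo suc (suc n) ⟩
    suc n                             ∎
    where open ≡-Reasoning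

  private
    n≡l+i : n ≡ l + i
    n≡l+i = ℕₚ.suc-injective (trans (sym unglue-size) (ℕₚ.+-suc l i))

    l<N : l < suc n
    l<N = subst (l <_) unglue-size (ℕₚ.m<m+n l (s≤s z≤n))

    rest : p ∷ π₁ ++ π₂ ↭ oneTo n
    rest = drop-mid (p ∷ π₁) [] (↭-trans perm (oneTo-suc-↭ n))

    π₂<N : ∀ {c} → c ∈ π₂ → c < suc n
    π₂<N c∈ = s≤s (proj₂ (∈-oneTo⁻ (∈-resp-↭ rest (∈-++⁺ʳ (p ∷ π₁) c∈))))

    one-below : All (λ c → c < suc n → rank (p ∷ π₁) c ≤ 1) π₂
    one-below = proj₁ (inClassAfter-++⁻ʳ [] (p ∷ π₁) (suc n ∷ π₂) ic)

    -- There are c − 1 entries below c, of which at most one precedes the maximum.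
    π₂≤l : ∀ {c} → c ∈ π₂ → c ≤ l
    π₂≤l {c} c∈ = begin
      c                                  ≡⟨ rank-oneTo n (∈-resp-↭ rest (∈-++⁺ʳ (p ∷ π₁) c∈)) ⟨
      suc (rank (oneTo n) c)             ≡⟨ cong suc (↭-length (filter-↭ (λ x → T? (x <ᵇ c)) rest)) ⟨
      suc (rank (p ∷ π₁ ++ π₂) c)        ≡⟨ cong suc (cnt-++ (_<ᵇ c) (p ∷ π₁) π₂) ⟩
      suc (rank (p ∷ π₁) c + rank π₂ c)  ≤⟨ s≤s (ℕₚ.+-monoˡ-≤ (rank π₂ c) (All.lookup one-below c∈ (π₂<N c∈))) ⟩
      -- The entry `c` is in `π₂` but not below itself, which makes the bound by `length π₂` strict.
      suc (suc (rank π₂ c))              ≤⟨ s≤s (filter-notAll (λ x → T? (x <ᵇ c)) π₂ (lose c∈ (ℕₚ.n≮n c ∘ ℕₚ.<ᵇ⇒< c c))) ⟩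
      l                                  ∎
      where open ℕₚ.≤-Reasoning

    -- Of the values 1, ..., l all but one are taken by `π₂`. The one left for the prefix is `s`;
    -- the other entries of the prefix exceed `l`.
    low = filterᵇ (_<ᵇ suc l) (p ∷ π₁)
    high = filterᵇ (not ∘ (_<ᵇ suc l)) (p ∷ π₁)

    low-↭ : low ++ π₂ ↭ oneTo l
    low-↭ = begin
      low ++ π₂                              ≡⟨ cong (low ++_) (filter-<-all (All.tabulate (s≤s ∘ π₂≤l))) ⟨
      low ++ filterᵇ (_<ᵇ suc l) π₂          ≡⟨ filter-++ _ (p ∷ π₁) π₂ ⟨
      filterᵇ (_<ᵇ suc l) (p ∷ π₁ ++ π₂)     ↭⟨ filter-↭ (λ x → T? (x <ᵇ suc l)) rest ⟩
      filterᵇ (_<ᵇ suc l) (oneTo n)          ≡⟨ cong (filterᵇ (_<ᵇ suc l) ∘ oneTo) n≡l+i ⟩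
      filterᵇ (_<ᵇ suc l) (oneTo (l + i))    ≡⟨ filter-oneTo l i ⟩
      oneTo l                                ∎
      where open PermutationReasoning

    low-singleton : ∃ λ s → low ≡ [ s ]
    low-singleton = singleton low (ℕₚ.+-cancelʳ-≡ (length π₂) (length low) 1
      (trans (sym (length-++ low)) (trans (↭-length low-↭) (length-applyUpTo suc l))))
      where
      singleton : ∀ (xs : List ℕ) → length xs ≡ 1 → ∃ λ s → xs ≡ [ s ]
      singleton (s ∷ []) refl = s , refl

    s = proj₁ low-singleton
    A = applyUpTo (λ j → suc (l + j)) i

    σ-perm : s ∷ π₂ ↭ oneTo l
    σ-perm = subst (λ u → u ++ π₂ ↭ oneTo l) (proj₂ low-singleton) low-↭

    π₁-↭ : p ∷ π₁ ↭ s ∷ high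
    π₁-↭ = subst (λ u → p ∷ π₁ ↭ u ++ high) (proj₂ low-singleton) (partition-↭ (_<ᵇ suc l) (p ∷ π₁))

    high-↭ : high ↭ A
    high-↭ = ↭-++-cancelˡ (oneTo l) (begin
      oneTo l ++ high     ↭⟨ ++-↭ʳ high σ-perm ⟨
      s ∷ π₂ ++ high      ↭⟨ prep s (++-comm π₂ high) ⟩
      s ∷ high ++ π₂      ↭⟨ ++-↭ʳ π₂ π₁-↭ ⟨
      p ∷ π₁ ++ π₂        ↭⟨ rest ⟩
      oneTo n             ≡⟨ cong oneTo n≡l+i ⟩
      oneTo (l + i)       ≡⟨ oneTo-+ l i ⟩
      oneTo l ++ A        ∎)
      where open PermutationReasoning

    -- The prefix rearranges `s`, l + 1, ..., l + i, which is the image of 1, ..., i + 1 under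
    -- `spread`; pulling the rearrangement back yields `ρ`.
    preimage : ∃ λ ρ → p ∷ π₁ ≡ map (spread s l) ρ × oneTo (suc i) ↭ ρ
    preimage = ↭-map-inv (spread s l) (begin
      map (spread s l) (oneTo (suc i))  ≡⟨ cong (s ∷_) (map-applyUpTo (suc ∘ suc) (spread s l) i) ⟩
      s ∷ A                             ↭⟨ prep s high-↭ ⟨
      s ∷ high                          ↭⟨ π₁-↭ ⟨
      p ∷ π₁                            ∎)
      where open PermutationReasoning

  unglue : ∃ λ r → ∃ λ ρ → ∃ λ s → length ρ ≡ length π₁ × IsPermutation (r ∷ ρ) × IsPermutation (s ∷ π₂)
    × glue (r ∷ ρ) (s ∷ π₂) ≡ p ∷ π₁ ++ suc n ∷ π₂
  unglue with preimage
  ... | r ∷ ρ , eq , ρ↭ = r , ρ , s , len , ↭-trans (↭-sym ρ↭) (↭-reflexive (cong (oneTo ∘ suc) (sym len))) , σ-perm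
        , cong₂ (λ u N → u ++ N ∷ π₂) (sym eq) (trans (cong (λ m → l + suc m) len) unglue-size)
    where
    len : length ρ ≡ length π₁
    len = ℕₚ.suc-injective (trans (sym (length-map (spread s l) (r ∷ ρ))) (cong length (sym eq)))

-- Duplicate-free lists of class members and of gluings

class : ℕ → List (List ℕ)
class n = filterᵇ inClassᵇ (perms n)

-- Drops the empty permutation, which is no part of a gluing; this accounts for the `- 1` in H - 1
-- and H′ - 1.
class⁺ : ℕ → List (List ℕ)
class⁺ zero    = []
class⁺ (suc n) = class (suc n)

unique-class : ∀ n → Unique (class n)
unique-class n = Uniqueₚ.filter⁺ _ (unique-arrangements (unique-oneTo n))

∈-class⁺ : ∀ {n π} → π ↭ oneTo n → T (inClassᵇ π) → π ∈ class n
∈-class⁺ {n} π-perm t = ∈-filter⁺ _ (∈-arrangements⁺ (oneTo n) π-perm) t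

∈-class⁻ : ∀ {n π} → π ∈ class n → π ↭ oneTo n × T (inClassᵇ π)
∈-class⁻ {n} π∈ = let (π∈′ , t) = ∈-filter⁻ (λ π → T? (inClassᵇ π)) π∈ in ∈-arrangements⁻ (oneTo n) π∈′ , t

data NonemptyMember (n : ℕ) : List ℕ → Set where
  member : ∀ {x xs} → suc (length xs) ≡ n → IsPermutation (x ∷ xs) → T (inClassᵇ (x ∷ xs)) → NonemptyMember n (x ∷ xs)

class⁺-member : ∀ {n π} → π ∈ class⁺ n → NonemptyMember n π
class⁺-member {suc n} {[]}     π∈ with () ← ↭-length (proj₁ (∈-class⁻ {suc n} π∈))
class⁺-member {suc n} {x ∷ xs} π∈ = member len (subst (λ m → x ∷ xs ↭ oneTo m) (sym len) π-perm) t
  where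
  π-perm = proj₁ (∈-class⁻ {suc n} π∈)
  t = proj₂ (∈-class⁻ {suc n} π∈)
  len = trans (↭-length π-perm) (length-applyUpTo suc (suc n))

member-class⁺ : ∀ {x xs} → IsPermutation (x ∷ xs) → T (inClassᵇ (x ∷ xs)) → x ∷ xs ∈ class⁺ (suc (length xs))
member-class⁺ π-perm t = ∈-class⁺ π-perm t

unique-class⁺ : ∀ n → Unique (class⁺ n)
unique-class⁺ zero    = []
unique-class⁺ (suc n) = unique-class (suc n)

-- The sizes i + 1 and n - i add up to n + 1. Indexing by i from 0 makes the sum over i a Cauchy
-- product at n whose left factor is a tail.
gluings : ℕ → ℕ → List (List ℕ)
gluings n i = concatMap (λ ρ → map (glue ρ) (class⁺ (n ∸ i))) (class⁺ (suc i))

decomposition : ℕ → List (List ℕ)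
decomposition n = map (suc n ∷_) (class n) ++ concatMap (gluings n) (upTo (suc n))

data Gluing (n i : ℕ) : List ℕ → Set where
  gluing : ∀ {r ρ s π} → suc (length ρ) ≡ suc i → suc (length π) + suc (length ρ) ≡ suc n →
    IsPermutation (r ∷ ρ) → T (inClassᵇ (r ∷ ρ)) → IsPermutation (s ∷ π) → T (inClassᵇ (s ∷ π)) →
    Gluing n i (glue (r ∷ ρ) (s ∷ π))

glue-size : ∀ {n i j k} → i < suc n → j ≡ suc i → k ≡ n ∸ i → k + j ≡ suc n
glue-size {n} {i} (s≤s i≤n) refl refl = trans (ℕₚ.+-suc (n ∸ i) i) (cong suc (ℕₚ.m∸n+n≡m i≤n))

∈-gluings⁻ : ∀ {n i π} → i < suc n → π ∈ gluings n i → Gluing n i π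
∈-gluings⁻ {n} {i} i<n π∈
  with ρ , ρ∈ , π∈′ ← find (∈-concatMap⁻ (λ ρ → map (glue ρ) (class⁺ (n ∸ i))) {xs = class⁺ (suc i)} π∈)
  with σ , σ∈ , refl ← ∈-map⁻ (glue ρ) π∈′
  with member eqρ pρ tρ ← class⁺-member {suc i} ρ∈ | member eqσ pσ tσ ← class⁺-member {n ∸ i} σ∈ =
  gluing eqρ (glue-size i<n eqρ eqσ) pρ tρ pσ tσ

glue-∈-gluings : ∀ {r ρ s π n} → suc (length π) + suc (length ρ) ≡ suc n →
  IsPermutation (r ∷ ρ) → T (inClassᵇ (r ∷ ρ)) → IsPermutation (s ∷ π) → T (inClassᵇ (s ∷ π)) →
  glue (r ∷ ρ) (s ∷ π) ∈ concatMap (gluings n) (upTo (suc n))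
glue-∈-gluings {r} {ρ} {s} {π} {n} size pρ tρ pσ tσ =
  ∈-concatMap⁺ (gluings n) (lose (∈-upTo⁺ i<N)
    (∈-concatMap⁺ (λ ρ′ → map (glue ρ′) (class⁺ (n ∸ length ρ))) (lose (member-class⁺ pρ tρ)
      (∈-map⁺ (glue (r ∷ ρ)) (subst (λ m → s ∷ π ∈ class⁺ m) σ-size (member-class⁺ pσ tσ))))))
  where
  i<N : length ρ < suc n
  i<N = subst (length ρ <_) size (ℕₚ.m≤n+m (suc (length ρ)) (suc (length π)))
  σ-size : suc (length π) ≡ n ∸ length ρ
  σ-size = trans (sym (ℕₚ.m+n∸n≡m (suc (length π)) (suc (length ρ)))) (cong (_∸ suc (length ρ)) size)

max-∷-class : ∀ {n π} → π ↭ oneTo n → T (inClassᵇ (suc n ∷ π)) ⇔ T (inClassᵇ π)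
max-∷-class {n} {π} π-perm = mk⇔
  (λ t → from (inClass⇔ uπ) (to (inClassAfter-max-∷ π<N) (to (inClass⇔ uN) t)))
  (λ t → from (inClass⇔ uN) (from (inClassAfter-max-∷ π<N) (to (inClass⇔ uπ) t)))
  where
  open Equivalence
  uπ = unique-↭-oneTo π-perm
  uN = unique-↭-oneTo (↭-trans (prep (suc n) π-perm) (↭-sym (oneTo-suc-↭ n)))
  π<N : All (_< suc n) π
  π<N = All.tabulate (λ x∈ → s≤s (proj₂ (∈-oneTo⁻ (∈-resp-↭ π-perm x∈))))

class⊆decomposition : ∀ {n π} → π ∈ class (suc n) → π ∈ decomposition n
class⊆decomposition {n} π∈ with ∈-class⁻ π∈
... | perm , t with ∈-∃++ (∈-resp-↭ (↭-sym perm) (∈-resp-↭ (↭-sym (oneTo-suc-↭ n)) (here refl)))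
...   | [] , π₂ , refl = ∈-++⁺ˡ (∈-map⁺ (suc n ∷_) (∈-class⁺ π₂-perm (Equivalence.to (max-∷-class π₂-perm) t)))
  where π₂-perm = drop-∷ (↭-trans perm (oneTo-suc-↭ n))
...   | p ∷ π₁ , π₂ , refl
  with ic ← Equivalence.to (inClass⇔ (unique-↭-oneTo perm)) t
  with r , ρ , s , len , pρ , pσ , eq ← unglue perm ic =
  ∈-++⁺ʳ (map (suc n ∷_) (class n)) (subst (_∈ concatMap (gluings n) (upTo (suc n))) eq
    (glue-∈-gluings (trans (cong (λ m → suc (length π₂) + suc m) len) (unglue-size perm ic)) pρ (proj₁ ts) pσ (proj₂ ts)))
  where ts = inClass-glue⁻ pρ pσ (subst (T ∘ inClassᵇ) (sym eq) t)

∈-all-gluings⁻ : ∀ {n π} → π ∈ concatMap (gluings n) (upTo (suc n)) → ∃ λ i → Gluing n i π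
∈-all-gluings⁻ {n} π∈ with i , i∈ , π∈′ ← find (∈-concatMap⁻ (gluings n) {xs = upTo (suc n)} π∈) =
  i , ∈-gluings⁻ (∈-upTo⁻ i∈) π∈′

decomposition⊆class : ∀ {n π} → π ∈ decomposition n → π ∈ class (suc n)
decomposition⊆class {n} π∈ with ∈-++⁻ (map (suc n ∷_) (class n)) π∈
... | inj₁ π∈′ with _ , π₂∈ , refl ← map∷⁻ π∈′ with π₂-perm , t ← ∈-class⁻ π₂∈ =
  ∈-class⁺ (↭-trans (prep (suc n) π₂-perm) (↭-sym (oneTo-suc-↭ n))) (Equivalence.from (max-∷-class π₂-perm) t)
... | inj₂ π∈′ with ∈-all-gluings⁻ {n} π∈′
...   | _ , gluing {r} {ρ} {s} {π} _ size pρ tρ pσ tσ =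
  ∈-class⁺ (subst (λ N → glue (r ∷ ρ) (s ∷ π) ↭ oneTo N) size (Glue.glue-↭ pρ pσ)) (inClass-glue⁺ pρ pσ tρ tσ)

gluing-injective : ∀ {n ρ σ ρ′ σ′ i j k l} →
  NonemptyMember (suc i) ρ → NonemptyMember k σ → NonemptyMember (suc j) ρ′ → NonemptyMember l σ′ →
  k + suc i ≡ suc n → l + suc j ≡ suc n → glue ρ σ ≡ glue ρ′ σ′ → ρ ≡ ρ′ × σ ≡ σ′
gluing-injective (member refl pρ _) (member refl pσ _) (member refl pρ′ _) (member refl pσ′ _) e e′ eq =
  glue-injective pρ pσ pρ′ pσ′ (trans e (sym e′)) eq

unique-decomposition : ∀ n → Unique (decomposition n)
unique-decomposition n = Uniqueₚ.++⁺ (Uniqueₚ.map⁺ ∷-injectiveʳ (unique-class n)) unique-gluings disjoint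
  where
  -- A gluing starts with an entry of its nonempty prefix, hence below the maximum.
  disjoint : ∀ {π} → ¬ (π ∈ map (suc n ∷_) (class n) × π ∈ concatMap (gluings n) (upTo (suc n)))
  disjoint (π∈ , π∈′) with _ , _ , refl ← map∷⁻ π∈ = absurd (proj₂ (∈-all-gluings⁻ {n} π∈′)) refl
    where
    absurd : ∀ {i π π′} → Gluing n i π → π ≢ suc n ∷ π′
    absurd (gluing _ size pρ _ pσ _) eq =
      ℕₚ.<-irrefl (trans (∷-injectiveˡ eq) (sym size)) (All.head (Glue.f<N pρ pσ))

  size : ∀ {i} → i ∈ upTo (suc n) → (n ∸ i) + suc i ≡ suc n
  size i∈ = glue-size (∈-upTo⁻ i∈) refl refl

  injective : ∀ {i j ρ σ ρ′ σ′} → i ∈ upTo (suc n) → j ∈ upTo (suc n) →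
    ρ ∈ class⁺ (suc i) → σ ∈ class⁺ (n ∸ i) → ρ′ ∈ class⁺ (suc j) → σ′ ∈ class⁺ (n ∸ j) →
    glue ρ σ ≡ glue ρ′ σ′ → ρ ≡ ρ′ × σ ≡ σ′
  injective {i} {j} i∈ j∈ ρ∈ σ∈ ρ′∈ σ′∈ = gluing-injective
    (class⁺-member {suc i} ρ∈) (class⁺-member {n ∸ i} σ∈) (class⁺-member {suc j} ρ′∈) (class⁺-member {n ∸ j} σ′∈)
    (size i∈) (size j∈)

  unique-gluings : Unique (concatMap (gluings n) (upTo (suc n)))
  unique-gluings = unique-concatMap (gluings n) (Uniqueₚ.upTo⁺ (suc n))
    (λ {i} i∈ → unique-concatMap (λ ρ → map (glue ρ) (class⁺ (n ∸ i))) (unique-class⁺ (suc i))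
      (λ {ρ} ρ∈ → unique-map-∈ (glue ρ) (unique-class⁺ (n ∸ i))
        (λ σ∈ σ′∈ eq → proj₂ (injective i∈ i∈ ρ∈ σ∈ ρ∈ σ′∈ eq)))
      (λ {ρ} {ρ′} ρ∈ ρ′∈ p q →
        let (σ , σ∈ , e) = ∈-map⁻ (glue ρ) p ; (σ′ , σ′∈ , e′) = ∈-map⁻ (glue ρ′) q
        in proj₁ (injective i∈ i∈ ρ∈ σ∈ ρ′∈ σ′∈ (trans (sym e) e′))))
    -- The glued list determines `ρ`, whose length determines the index.
    λ {i} {j} i∈ j∈ p q →
      let (ρ , ρ∈ , p′) = find (∈-concatMap⁻ (λ ρ → map (glue ρ) (class⁺ (n ∸ i))) {xs = class⁺ (suc i)} p)
          (ρ′ , ρ′∈ , q′) = find (∈-concatMap⁻ (λ ρ → map (glue ρ) (class⁺ (n ∸ j))) {xs = class⁺ (suc j)} q)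
          (σ , σ∈ , e) = ∈-map⁻ (glue ρ) p′
          (σ′ , σ′∈ , e′) = ∈-map⁻ (glue ρ′) q′
          ρ≡ρ′ = proj₁ (injective i∈ j∈ ρ∈ σ∈ ρ′∈ σ′∈ (trans (sym e) e′))
      in ℕₚ.suc-injective (trans (sym (size-of ρ∈)) (trans (cong length ρ≡ρ′) (size-of ρ′∈)))
    where
    size-of : ∀ {i ρ} → ρ ∈ class⁺ (suc i) → length ρ ≡ suc i
    size-of {i} ρ∈ with member eq _ _ ← class⁺-member {suc i} ρ∈ = eq

class-↭ : ∀ n → class (suc n) ↭ decomposition n
class-↭ n = set-unique⇒↭ (unique-class (suc n)) (unique-decomposition n)
  (class⊆decomposition {n}) (decomposition⊆class {n})

-- The recurrences

avoids-⊆ : ∀ {σ s π} → s ⊆ π → occ σ π ≡ 0 → occ σ s ≡ 0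
avoids-⊆ {σ} {s} {π} s⊆π none = avoids⁺ σ s (λ t⊆s → avoids⁻ σ π none (⊆-trans t⊆s s⊆π))

occAfter-avoids : ∀ {τ} p q → occ τ (p ++ q) ≡ 0 → occAfter τ p q ≡ 0
occAfter-avoids p []      none = refl
occAfter-avoids {τ} p (z ∷ q) none = cong₂ _+_
  (avoids-⊆ {τ} (⊆-trans (filter-⊆ (λ x → T? (x <ᵇ z)) p)
     (subst (_⊆ p ++ z ∷ q) (++-identityʳ p) (++-⊆ ⊆-refl (minimum _)))) none)
  (occAfter-avoids {τ} (p ++ [ z ]) q (trans (cong (occ τ) (++-assoc p [ z ] q)) none))

-- Deleting the last entry of an occurrence of τ,k leaves one of τ.
avoids-∷ʳ : ∀ {t τ k} → All (_< k) (t ∷ τ) → ∀ π → occ (t ∷ τ) π ≡ 0 → occ (t ∷ τ ++ [ k ]) π ≡ 0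
avoids-∷ʳ τ<k π none = trans (occ-++ τ<k [] π) (occAfter-avoids [] π none)

𝟙-avoids-split : ∀ a b c → (b ≡ 0 → a ≡ 0) → 𝟙 (a + b + c ≡ᵇ 0) ≡ 𝟙 (b ≡ᵇ 0) ℤ.* 𝟙 (c ≡ᵇ 0)
𝟙-avoids-split a zero c b₀⇒a₀ rewrite b₀⇒a₀ refl = sym (ℤₚ.*-identityˡ _)
𝟙-avoids-split a (suc b) c _ rewrite ℕₚ.+-suc a b = refl

-- The hypothesis rules out `a = 1`, `b = 0`. So `a + b = 1` means `a = 0` and `b = 1`, the two
-- conditions in J, while `a + b = 0` is just `b = 0`.
𝟙-once-split : ∀ a b c → (b ≡ 0 → a ≡ 0) → 𝟙 (a + b + c ≡ᵇ 1)
  ≡ 𝟙 ((a ≡ᵇ 0) ∧ (b ≡ᵇ 1)) ℤ.* 𝟙 (c ≡ᵇ 0) ℤ.+ 𝟙 (b ≡ᵇ 0) ℤ.* 𝟙 (c ≡ᵇ 1)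
𝟙-once-split a zero c b₀⇒a₀ rewrite b₀⇒a₀ refl =
  sym (trans (ℤₚ.+-identityˡ _) (ℤₚ.*-identityˡ _))
𝟙-once-split zero    (suc zero)    c _ = sym (trans (ℤₚ.+-identityʳ _) (ℤₚ.*-identityˡ _))
𝟙-once-split zero    (suc (suc b)) c _ = refl
𝟙-once-split (suc a) (suc b)       c _ rewrite ℕₚ.+-suc a b = refl

module _ {t τ} (τ-perm : IsPermutation (t ∷ τ)) where

  private
    k = suc (length (t ∷ τ))
    τk = appendMax (t ∷ τ)

    τ<k : All (_< k) (t ∷ τ)
    τ<k = All.tabulate (λ x∈ → s≤s (proj₂ (∈-oneTo⁻ (∈-resp-↭ τ-perm x∈))))

    av av⁺ once⁺ jw : List ℕ → ℤ
    av    π = 𝟙 (avoidsᵇ (t ∷ τ) π)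
    av⁺   π = 𝟙 (avoidsᵇ τk π)
    once⁺ π = 𝟙 (exactlyOnceᵇ τk π)
    jw    π = 𝟙 (avoidsᵇ τk π ∧ exactlyOnceᵇ (t ∷ τ) π)

    h₊ : Series
    h₊ n = wsum av⁺ (class⁺ n)

    h≡ : ∀ n → ofℕ (hCoeff (t ∷ τ)) n ≡ wsum av (class n)
    h≡ n = length-filterᵇ-∧ inClassᵇ (avoidsᵇ (t ∷ τ)) (perms n)

    g≡ : ∀ n → ofℕ (gCoeff τk) n ≡ wsum once⁺ (class n)
    g≡ n = length-filterᵇ-∧ inClassᵇ (exactlyOnceᵇ τk) (perms n)

    j≡ : ∀ n → ofℕ (jCoeff (t ∷ τ)) n ≡ wsum jw (class n)
    j≡ n = length-filterᵇ-∧ inClassᵇ (λ π → avoidsᵇ τk π ∧ exactlyOnceᵇ (t ∷ τ) π) (perms n)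

    h g j : Series
    h n = wsum av (class n)
    g n = wsum once⁺ (class n)
    j n = wsum jw (class n)

    g₊ : ∀ n → wsum once⁺ (class⁺ n) ≡ g n
    g₊ zero    = refl
    g₊ (suc n) = refl

    -- The empty permutation avoids τ,k and supplies `one`; with a maximum placed in front of it, it
    -- becomes the term x of the equation for H′.
    h₊-class : ∀ n → wsum av⁺ (class n) ≡ one n ℤ.+ h₊ n
    h₊-class zero    = refl
    h₊-class (suc n) = sym (ℤₚ.+-identityˡ _)

    -- The predicate stays general so that one decomposition serves both series: `_≡ᵇ 0` gives H′
    -- and `_≡ᵇ 1` gives G.
    wsum-class : ∀ (q : ℕ → Bool) n → wsum (λ π → 𝟙 (q (occ τk π))) (class (suc n))
      ≡ wsum (λ π → 𝟙 (q (occ τk π))) (class n)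
        ℤ.+ wsum (λ i → wsum (λ ρ → wsum (λ σ →
              𝟙 (q (occ τk ρ + occ (t ∷ τ) ρ + occ τk σ))) (class⁺ (n ∸ i))) (class⁺ (suc i))) (upTo (suc n))
    wsum-class q n = begin
      wsum w (class (suc n))
        ≡⟨ wsum-↭ w (class-↭ n) ⟩
      wsum w (decomposition n)
        ≡⟨ wsum-++ w (map (suc n ∷_) (class n)) _ ⟩
      wsum w (map (suc n ∷_) (class n)) ℤ.+ wsum w (concatMap (gluings n) (upTo (suc n)))
        ≡⟨ cong₂ ℤ._+_
             (trans (wsum-map w (suc n ∷_) (class n)) (wsum-cong-∈ (class n) leading-max))
             (trans (wsum-concatMap w (gluings n) (upTo (suc n))) (wsum-cong-∈ (upTo (suc n)) (λ {i} _ → glued i))) ⟩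
      _ ∎
      where
      open ≡-Reasoning
      w : List ℕ → ℤ
      w π = 𝟙 (q (occ τk π))
      leading-max : ∀ {π} → π ∈ class n → w (suc n ∷ π) ≡ w π
      leading-max π∈ = cong (𝟙 ∘ q) (occ-max-∷ τ<k
        (All.tabulate (λ x∈ → s≤s (proj₂ (∈-oneTo⁻ (∈-resp-↭ (proj₁ (∈-class⁻ {n} π∈)) x∈))))))
      glued-weight : ∀ {k l ρ σ} → NonemptyMember k ρ → NonemptyMember l σ →
        w (glue ρ σ) ≡ 𝟙 (q (occ τk ρ + occ (t ∷ τ) ρ + occ τk σ))
      glued-weight (member _ pρ _) (member _ pσ _) = cong (𝟙 ∘ q) (Glue.occ-glue pρ pσ τ<k)
      glued : ∀ i → wsum w (gluings n i) ≡
        wsum (λ ρ → wsum (λ σ → 𝟙 (q (occ τk ρ + occ (t ∷ τ) ρ + occ τk σ))) (class⁺ (n ∸ i))) (class⁺ (suc i))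
      glued i = trans (wsum-concatMap w (λ ρ → map (glue ρ) (class⁺ (n ∸ i))) (class⁺ (suc i)))
        (wsum-cong-∈ (class⁺ (suc i)) λ {ρ} ρ∈ →
          trans (wsum-map w (glue ρ) (class⁺ (n ∸ i)))
            (wsum-cong-∈ (class⁺ (n ∸ i)) λ σ∈ →
              glued-weight (class⁺-member {suc i} ρ∈) (class⁺-member {n ∸ i} σ∈)))

    wsum-⊛ : ∀ (u v : List ℕ → ℤ) n →
      wsum (λ i → wsum (λ ρ → wsum (λ σ → u ρ ℤ.* v σ) (class⁺ (n ∸ i))) (class⁺ (suc i))) (upTo (suc n))
        ≡ (tail⁺ (λ n → wsum u (class n)) ⊛ (λ n → wsum v (class⁺ n))) n
    wsum-⊛ u v n = wsum-cong-∈ (upTo (suc n)) (λ {i} _ → wsum-cartesian u v (class⁺ (suc i)) (class⁺ (n ∸ i)))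

    rec-h : ∀ n → h₊ (suc n) ≡ one n ℤ.+ h₊ n ℤ.+ (tail⁺ h ⊛ h₊) n
    rec-h n = trans (wsum-class (_≡ᵇ 0) n) (cong₂ ℤ._+_ (h₊-class n)
      (trans (wsum-cong-∈ (upTo (suc n)) λ {i} _ → wsum-cong-∈ (class⁺ (suc i)) λ {ρ} _ →
                wsum-cong-∈ (class⁺ (n ∸ i)) λ {σ} _ →
                  𝟙-avoids-split (occ τk ρ) (occ (t ∷ τ) ρ) (occ τk σ) (avoids-∷ʳ τ<k ρ))
             (wsum-⊛ av av⁺ n)))

    rec-g : ∀ n → g (suc n) ≡ g n ℤ.+ ((tail⁺ j ⊛ h₊) n ℤ.+ (tail⁺ h ⊛ g) n)
    rec-g n = trans (wsum-class (_≡ᵇ 1) n) (cong (λ s → g n ℤ.+ s) (begin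
      wsum (λ i → wsum (λ ρ → wsum (λ σ → 𝟙 (occ τk ρ + occ (t ∷ τ) ρ + occ τk σ ≡ᵇ 1)) (class⁺ (n ∸ i))) (class⁺ (suc i))) is
        ≡⟨ (wsum-cong-∈ is λ {i} _ → trans
              (wsum-cong-∈ (class⁺ (suc i)) λ {ρ} _ → trans
                (wsum-cong-∈ (class⁺ (n ∸ i)) λ {σ} _ →
                  𝟙-once-split (occ τk ρ) (occ (t ∷ τ) ρ) (occ τk σ) (avoids-∷ʳ τ<k ρ))
                (wsum-+ (λ σ → jw ρ ℤ.* av⁺ σ) (λ σ → av ρ ℤ.* once⁺ σ) (class⁺ (n ∸ i))))
              (wsum-+ (λ ρ → wsum (λ σ → jw ρ ℤ.* av⁺ σ) (class⁺ (n ∸ i)))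
                      (λ ρ → wsum (λ σ → av ρ ℤ.* once⁺ σ) (class⁺ (n ∸ i))) (class⁺ (suc i)))) ⟩
      wsum (λ i → product-sum jw av⁺ i ℤ.+ product-sum av once⁺ i) is
        ≡⟨ wsum-+ (product-sum jw av⁺) (product-sum av once⁺) is ⟩
      wsum (product-sum jw av⁺) is ℤ.+ wsum (product-sum av once⁺) is
        ≡⟨ cong₂ ℤ._+_ (wsum-⊛ jw av⁺ n)
             (trans (wsum-⊛ av once⁺ n) (⊛-cong {a = tail⁺ h} (λ _ → refl) g₊ n)) ⟩
      (tail⁺ j ⊛ h₊) n ℤ.+ (tail⁺ h ⊛ g) n ∎))
      where
      open ≡-Reasoning
      is = upTo (suc n)
      product-sum : (List ℕ → ℤ) → (List ℕ → ℤ) → ℕ → ℤ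
      product-sum u v i = wsum (λ ρ → wsum (λ σ → u ρ ℤ.* v σ) (class⁺ (n ∸ i))) (class⁺ (suc i))

  generating-function :
    ofℕ (gCoeff τk) ⊛ (twoMinusXMinus (ofℕ (hCoeff (t ∷ τ))) ⊛ twoMinusXMinus (ofℕ (hCoeff (t ∷ τ))))
    ≗ xTimes (ofℕ (jCoeff (t ∷ τ)))
  generating-function = series-solution
    -- The four `refl` are constant terms: the empty permutation avoids the nonempty τ and τ,k, and
    -- `class⁺ 0` is empty.
    (ofℕ (gCoeff τk)) (ofℕ (hCoeff (t ∷ τ))) h₊ (ofℕ (jCoeff (t ∷ τ))) refl refl refl refl
    (λ n → trans (rec-h n) (cong (λ s → one n ℤ.+ h₊ n ℤ.+ s) (⊛-cong {b = h₊} (sym ∘ h≡ ∘ suc) (λ _ → refl) n)))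
    (λ n → trans (g≡ (suc n)) (trans (rec-g n) (cong₂ ℤ._+_ (sym (g≡ n))
      (cong₂ ℤ._+_ (⊛-cong {b = h₊} (sym ∘ j≡ ∘ suc) (λ _ → refl) n) (⊛-cong (sym ∘ h≡ ∘ suc) (sym ∘ g≡) n)))))

theorem8p2 : (τ : List ℕ) → τ ↭ oneTo (length τ) → length τ ≥ 1 → T (inClassᵇ τ) →
    (n : ℕ) →
    (ofℕ (gCoeff (appendMax τ))
    ⊛ (twoMinusXMinus (ofℕ (hCoeff τ)) ⊛ twoMinusXMinus (ofℕ (hCoeff τ)))) n
    ≡ xTimes (ofℕ (jCoeff τ)) n
theorem8p2 (t ∷ τ) τ-perm _ _ = generating-function τ-perm
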